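{- Any data structure that can be used to represent an array $A[1..n]$ and support $1/k$-majority decision queries, for any integer $k \ge 2$, on any arbitrary query range $[i,j]$, requires $n \lg \frac{k}{e} - \Theta(k^4 \lg k)$ bits of space. (That is, for every integer $k\ge 2$, any such data structure uses, in the worst case over arrays of length $n$, at least $n\lg\frac{k}{e}-\Theta(k^4\lg k)$ bits.)
   Context: Notation: $\lg x=\log_2 x$, and $e$ is the base of the natural logarithm. The array $A[1..n]$ has $n$ elements from an arbitrary (unrestricted) alphabet. For $\tau\in(0,1)$ and $1\le i\le j\le n$, a $\tau$-majority of $A[i..j]$ is an element that occurs at least $\tau(j-i+1)$ times in $A[i..j]$. A (range) $\tau$-majority decision query is given $i,j$ with $1\le i\le j\le n$ and asks: "Is there at least one element in the query range $A[i..j]$ which is a $\tau$-majority of $A[i..j]$?"; the answer is YES or NO. A data structure (encoding) assigns to each array $A$ of length $n$ a bit string from which alone (without access to $A$) the answers to all such queries on $A$ can be determined; its space is the length of the bit string. The constant hidden in $\Theta(k^4\lg k)$ does not depend on $n$ or $k$. -}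

module Defs where

open import Data.Bool.Base using (Bool; true)
open import Data.Empty using (⊥; ⊥-elim)
open import Data.Fin.Base as Fin using (Fin; toℕ)
import Data.Fin.Properties as Fin
open import Data.Integer.Base as ℤ using (ℤ; +_; -[1+_])
import Data.Integer.Properties as ℤ
open import Data.List.Base using (List; length; filter; allFin)
open import Data.Nat.Base as ℕ using (ℕ; zero; suc; _!)
import Data.Nat.Properties as ℕ
open import Data.Product.Base using (∃; ∃-syntax; _×_; _,_; proj₁; proj₂)
open import Data.Rational.Base
open import Data.Rational.Properties
open import Data.Rational.Solver using (module +-*-Solver)
import Data.Rational.Unnormalised.Base as ℚᵘ
import Data.Rational.Unnormalised.Properties as ℚᵘ
open import Data.Sum.Base using (_⊎_; inj₁; inj₂; swap)
open import Data.Vec.Base using (Vec; lookup)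
open import Function.Bundles using (_⇔_)
open import Relation.Binary.Definitions using (tri<; tri≈; tri>)
open import Relation.Binary.PropositionalEquality
open import Relation.Nullary using (Dec; yes; no)
open import Relation.Nullary.Decidable using (_×-dec_)

open import Algebra.Bundles using (CommutativeRing)
open import Algebra.Properties.CommutativeSemiring.Exp
  (CommutativeRing.commutativeSemiring +-*-commutativeRing) public
  using (_^_; ^-homo-*; ^-assocʳ; ^-distrib-*)

nat : ℕ → ℚ
nat n = + n / 1

2ℚ : ℚ
2ℚ = nat 2

pow2 : ℤ → ℚ
pow2 (+ n)    = 2ℚ ^ n
pow2 -[1+ n ] = ½ ^ suc n

module RationalLemmas where
  open +-*-Solver

  toℚᵘ-/ : ∀ a b .{{_ : ℕ.NonZero b}} → toℚᵘ (a / b) ℚᵘ.≃ (a ℚᵘ./ b)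
  toℚᵘ-/ a (suc b) = toℚᵘ-fromℚᵘ (ℚᵘ.mkℚᵘ a b)

  </ : ∀ {q a b} .{{_ : ℕ.NonZero b}} → ↥ q ℤ.* + b ℤ.< a ℤ.* ↧ q → q < a / b
  </ {q@record{}} {a} {suc b} h =
    toℚᵘ-cancel-< (ℚᵘ.<-respʳ-≃ (ℚᵘ.≃-sym (toℚᵘ-/ a (suc b))) (ℚᵘ.*<* h))

  /< : ∀ {q a b} .{{_ : ℕ.NonZero b}} → a ℤ.* ↧ q ℤ.< ↥ q ℤ.* + b → a / b < q
  /< {q@record{}} {a} {suc b} h =
    toℚᵘ-cancel-< (ℚᵘ.<-respˡ-≃ (ℚᵘ.≃-sym (toℚᵘ-/ a (suc b))) (ℚᵘ.*<* h))

  cross-/ : ∀ a b .{{_ : ℕ.NonZero b}} → ↥ (a / b) ℤ.* + b ≡ a ℤ.* ↧ (a / b)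
  cross-/ a (suc b) with a / suc b | toℚᵘ-/ a (suc b)
  ... | record{} | ℚᵘ.*≡* eq = eq

  /-*-/ : ∀ a b c d .{{_ : ℕ.NonZero b}} .{{_ : ℕ.NonZero d}} .{{_ : ℕ.NonZero (b ℕ.* d)}} →
          (a / b) * (c / d) ≡ (a ℤ.* c) / (b ℕ.* d)
  /-*-/ a (suc b) c (suc d) = toℚᵘ-injective (begin
    toℚᵘ ((a / suc b) * (c / suc d))         ≈⟨ toℚᵘ-homo-* (a / suc b) (c / suc d) ⟩
    toℚᵘ (a / suc b) ℚᵘ.* toℚᵘ (c / suc d)   ≈⟨ ℚᵘ.*-cong (toℚᵘ-/ a (suc b)) (toℚᵘ-/ c (suc d)) ⟩
    (a ℤ.* c) ℚᵘ./ (suc b ℕ.* suc d)         ≈⟨ toℚᵘ-/ (a ℤ.* c) (suc b ℕ.* suc d) ⟨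
    toℚᵘ ((a ℤ.* c) / (suc b ℕ.* suc d))     ∎)
    where open ℚᵘ.≃-Reasoning

  nat-suc : ∀ n → nat (suc n) ≡ 1ℚ + nat n
  nat-suc n = toℚᵘ-injective (begin
    toℚᵘ (nat (suc n))           ≈⟨ toℚᵘ-/ (+ suc n) 1 ⟩
    + suc n ℚᵘ./ 1               ≈⟨ ℚᵘ.*≡* (cong (ℤ._* + 1) (cong (ℤ._+_ (+ 1)) (sym (ℤ.*-identityʳ (+ n))))) ⟩
    ℚᵘ.1ℚᵘ ℚᵘ.+ (+ n ℚᵘ./ 1)     ≈⟨ ℚᵘ.+-cong (toℚᵘ-/ (+ 1) 1) (toℚᵘ-/ (+ n) 1) ⟨
    toℚᵘ 1ℚ ℚᵘ.+ toℚᵘ (nat n)    ≈⟨ toℚᵘ-homo-+ 1ℚ (nat n) ⟨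
    toℚᵘ (1ℚ + nat n)            ∎)
    where open ℚᵘ.≃-Reasoning

  0<1 : 0ℚ < 1ℚ
  0<1 = positive⁻¹ 1ℚ

  0<2 : 0ℚ < 2ℚ
  0<2 = positive⁻¹ 2ℚ

  0<½ : 0ℚ < ½
  0<½ = positive⁻¹ ½

  1<2 : 1ℚ < 2ℚ
  1<2 = *<* (ℤ.+<+ (ℕ.s≤s (ℕ.s≤s ℕ.z≤n)))

  ½<1 : ½ < 1ℚ
  ½<1 = *<* (ℤ.+<+ (ℕ.s≤s (ℕ.s≤s ℕ.z≤n)))

  *-monoˡ-< : ∀ {r p q} → 0ℚ < r → p < q → r * p < r * q
  *-monoˡ-< {r} 0<r = *-monoʳ-<-pos r {{positive 0<r}}

  halve : ∀ {δ} → 0ℚ < δ → ∃[ h ] 0ℚ < h × h + h < δ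
  halve {δ} 0<δ =
    let (m , 0<m , m<δ) = <-dense 0<δ
    in ½ * m ,
       subst (_< ½ * m) (*-zeroʳ ½) (*-monoˡ-< {½} {0ℚ} {m} 0<½ 0<m) ,
       subst (_< δ) (sym (trans (sym (*-distribʳ-+ m ½ ½)) (*-identityˡ m))) m<δ

  shift-gap : ∀ p q l d → d < q - p → p - l < q - (l + d)
  shift-gap p q l d d<q-p = subst₂ _<_
    (solve 3 (λ a c d → a :- c :- d :+ d := a :- c) refl p l d)
    (solve 4 (λ a b c d → a :- c :- d :+ (b :- a) := b :- (c :+ d)) refl p q l d)
    (+-monoʳ-< (p - l - d) {d} {q - p} d<q-p)

  *-monoˡ-≤ : ∀ {r p q} → 0ℚ ≤ r → p ≤ q → r * p ≤ r * q
  *-monoˡ-≤ {r} 0≤r = *-monoˡ-≤-nonNeg r {{nonNegative 0≤r}}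

  *-monoʳ-≤ : ∀ {r p q} → 0ℚ ≤ r → p ≤ q → p * r ≤ q * r
  *-monoʳ-≤ {r} 0≤r = *-monoʳ-≤-nonNeg r {{nonNegative 0≤r}}

  *-pos : ∀ {p q} → 0ℚ < p → 0ℚ < q → 0ℚ < p * q
  *-pos {p} {q} 0<p 0<q = subst (_< p * q) (*-zeroʳ p) (*-monoˡ-< 0<p 0<q)

  *-nonNeg : ∀ {p q} → 0ℚ ≤ p → 0ℚ ≤ q → 0ℚ ≤ p * q
  *-nonNeg {p} {q} 0≤p 0≤q = subst (_≤ p * q) (*-zeroʳ p) (*-monoˡ-≤ 0≤p 0≤q)

  recip : ∀ {r} → 0ℚ < r → ∃[ s ] 0ℚ < s × r * s ≡ 1ℚ
  recip {r} 0<r = 1/ r , positive⁻¹ (1/ r) , *-inverseʳ r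
    where instance
      r>0 = positive 0<r
      r≢0 = >-nonZero 0<r
      r⁻¹>0 = 1/pos⇒pos r

  diff-pos : ∀ {p q} → p < q → 0ℚ < q - p
  diff-pos {p} {q} p<q = subst (_< q - p) (+-inverseʳ p) (+-monoˡ-< (- p) p<q)

  <-+ : ∀ {p δ} → 0ℚ < δ → p < p + δ
  <-+ {p} {δ} 0<δ = subst (_< p + δ) (+-identityʳ p) (+-monoʳ-< p 0<δ)

  nat-pos : ∀ k .{{_ : ℕ.NonZero k}} → 0ℚ < nat k
  nat-pos k = positive⁻¹ (nat k) {{normalize-pos k 1}}

  0≤nat : ∀ n → 0ℚ ≤ nat n
  0≤nat n = nonNegative⁻¹ (nat n) {{normalize-nonNeg n 1}}

  archimedean : ∀ q → ∃[ n ] q < nat n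
  archimedean q@(mkℚ (+ a) d _) = suc a , </ {q} {+ suc a} {1}
    (subst₂ ℤ._<_ (sym (ℤ.*-identityʳ (+ a))) (ℤ.pos-* (suc a) (suc d))
      (ℤ.+<+ (ℕ.m≤m*n (suc a) (suc d))))
  archimedean q@(mkℚ -[1+ a ] d _) = 0 , </ {q} {+ 0} {1} ℤ.-<+

  ^-pos : ∀ {x} n → 0ℚ < x → 0ℚ < x ^ n
  ^-pos zero    0<x = 0<1
  ^-pos (suc n) 0<x = *-pos 0<x (^-pos n 0<x)

  ^-mono-≤ : ∀ {x y} n → 0ℚ ≤ x → x ≤ y → 0ℚ ≤ x ^ n × x ^ n ≤ y ^ n
  ^-mono-≤ zero    0≤x x≤y = <⇒≤ 0<1 , ≤-refl
  ^-mono-≤ (suc n) 0≤x x≤y with ^-mono-≤ n 0≤x x≤y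
  ... | 0≤xⁿ , xⁿ≤yⁿ =
    *-nonNeg 0≤x 0≤xⁿ ,
    ≤-trans (*-monoˡ-≤ 0≤x xⁿ≤yⁿ) (*-monoʳ-≤ (≤-trans 0≤xⁿ xⁿ≤yⁿ) x≤y)

  ^-cancel-< : ∀ {x y} n → 0ℚ ≤ y → x ^ n < y ^ n → x < y
  ^-cancel-< {x} {y} n 0≤y h with x <? y
  ... | yes x<y = x<y
  ... | no  x≮y = ⊥-elim (<-irrefl refl (<-≤-trans h (proj₂ (^-mono-≤ n 0≤y (≮⇒≥ x≮y)))))

  ^-mono-< : ∀ {x y} n .{{_ : ℕ.NonZero n}} → 0ℚ < x → x < y → x ^ n < y ^ n
  ^-mono-< {x} {y} (suc n) 0<x x<y =
    ≤-<-trans (*-monoˡ-≤ (<⇒≤ 0<x) (proj₂ (^-mono-≤ n (<⇒≤ 0<x) (<⇒≤ x<y))))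
              (*-monoˡ-<-pos (y ^ n) {{positive (^-pos n (<-trans 0<x x<y))}} x<y)

  bernoulli : ∀ {δ} n → 0ℚ ≤ δ → 1ℚ + nat n * δ ≤ (1ℚ + δ) ^ n
  bernoulli {δ} zero    0≤δ = ≤-reflexive (trans (cong (λ z → 1ℚ + z) (*-zeroˡ δ)) (+-identityʳ 1ℚ))
  bernoulli {δ} (suc n) 0≤δ = begin
    1ℚ + nat (suc n) * δ               ≡⟨ cong (λ z → 1ℚ + z * δ) (nat-suc n) ⟩
    1ℚ + (1ℚ + nat n) * δ              ≡⟨ +-identityʳ _ ⟨
    1ℚ + (1ℚ + nat n) * δ + 0ℚ         ≤⟨ +-monoʳ-≤ (1ℚ + (1ℚ + nat n) * δ) {0ℚ} {nat n * δ * δ} (*-nonNeg (*-nonNeg (0≤nat n) 0≤δ) 0≤δ) ⟩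
    1ℚ + (1ℚ + nat n) * δ + nat n * δ * δ
      ≡⟨ solve 2 (λ m d → con 1ℚ :+ (con 1ℚ :+ m) :* d :+ m :* d :* d
                       := (con 1ℚ :+ d) :* (con 1ℚ :+ m :* d)) refl (nat n) δ ⟩
    (1ℚ + δ) * (1ℚ + nat n * δ)        ≤⟨ *-monoˡ-≤ (≤-trans 0≤δ (≤-trans (≤-reflexive (sym (+-identityˡ δ))) (+-monoˡ-≤ δ (<⇒≤ 0<1)))) (bernoulli n 0≤δ) ⟩
    (1ℚ + δ) ^ suc n                   ∎
    where open ≤-Reasoning

  ^-unbounded : ∀ {x} → 1ℚ < x → ∀ y → ∃[ n ] y < x ^ n
  ^-unbounded {x} 1<x y with recip (diff-pos 1<x)
  ... | v , 0<v , eq with archimedean (y * v)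
  ... | n , yv<n = n , (begin-strict
    y                         ≡⟨ trans (cong (y *_) (trans (*-comm v (x - 1ℚ)) eq)) (*-identityʳ y) ⟨
    y * (v * (x - 1ℚ))        ≡⟨ *-assoc y v (x - 1ℚ) ⟨
    y * v * (x - 1ℚ)          <⟨ *-monoˡ-<-pos (x - 1ℚ) {{positive (diff-pos 1<x)}} yv<n ⟩
    nat n * (x - 1ℚ)          ≡⟨ +-identityˡ _ ⟨
    0ℚ + nat n * (x - 1ℚ)     ≤⟨ +-monoˡ-≤ (nat n * (x - 1ℚ)) {0ℚ} {1ℚ} (<⇒≤ 0<1) ⟩
    1ℚ + nat n * (x - 1ℚ)     ≤⟨ bernoulli n (<⇒≤ (diff-pos 1<x)) ⟩
    (1ℚ + (x - 1ℚ)) ^ n       ≡⟨ cong (_^ n) (solve 1 (λ a → con 1ℚ :+ (a :- con 1ℚ) := a) refl x) ⟩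
    x ^ n                     ∎)
    where open ≤-Reasoning

  ^-ratio : ∀ {s t} → 0ℚ < s → s < t → ∃[ n ] 2ℚ * s ^ suc n < t ^ suc n
  ^-ratio {s} {t} 0<s s<t with recip 0<s
  ... | v , 0<v , eq = n , (begin-strict
    2ℚ * s ^ suc n                 <⟨ *-monoˡ-<-pos _ {{positive (^-pos (suc n) 0<s)}} 2<xˢⁿ ⟩
    (t * v) ^ suc n * s ^ suc n    ≡⟨ ^-distrib-* (t * v) s (suc n) ⟨
    (t * v * s) ^ suc n            ≡⟨ cong (_^ suc n) t*v*s≡t ⟩
    t ^ suc n                      ∎)
    where
    open ≤-Reasoning
    t*v*s≡t : t * v * s ≡ t
    t*v*s≡t = trans (*-assoc t v s) (trans (cong (t *_) (trans (*-comm v s) eq)) (*-identityʳ t))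
    1<tv : 1ℚ < t * v
    1<tv = subst (_< t * v) eq (*-monoˡ-<-pos v {{positive 0<v}} s<t)
    n = proj₁ (^-unbounded 1<tv 2ℚ)
    2<xˢⁿ : 2ℚ < (t * v) ^ suc n
    2<xˢⁿ = <-≤-trans (proj₂ (^-unbounded 1<tv 2ℚ))
      (≤-trans (≤-reflexive (sym (*-identityˡ _)))
        (*-monoʳ-≤ (<⇒≤ (^-pos n (<-trans 0<1 1<tv))) (<⇒≤ 1<tv)))

  ½ⁿ2ⁿ≡1 : ∀ m → ½ ^ m * 2ℚ ^ m ≡ 1ℚ
  ½ⁿ2ⁿ≡1 zero    = refl
  ½ⁿ2ⁿ≡1 (suc m) = begin
    ½ * ½ ^ m * (2ℚ * 2ℚ ^ m)
      ≡⟨ solve 4 (λ a b c d → a :* b :* (c :* d) := (a :* c) :* (b :* d)) refl ½ (½ ^ m) 2ℚ (2ℚ ^ m) ⟩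
    ½ * 2ℚ * (½ ^ m * 2ℚ ^ m)      ≡⟨ cong (λ z → ½ * 2ℚ * z) (½ⁿ2ⁿ≡1 m) ⟩
    ½ * 2ℚ * 1ℚ                    ≡⟨ refl ⟩
    1ℚ                             ∎
    where open ≡-Reasoning

  ½^-small : ∀ {r} → 0ℚ < r → ∃[ n ] ½ ^ n < r
  ½^-small {r} 0<r =
    let (v , 0<v , eq) = recip 0<r
        (n , v<2ⁿ)     = ^-unbounded 1<2 v
    in n , subst₂ _<_ (lhs n v eq) (rhs n)
             (*-monoˡ-< {½ ^ n * r} {v} {2ℚ ^ n} (*-pos {½ ^ n} {r} (^-pos n 0<½) 0<r) v<2ⁿ)
    where
    open ≡-Reasoning
    lhs : ∀ n v → r * v ≡ 1ℚ → ½ ^ n * r * v ≡ ½ ^ n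
    lhs n v eq = trans (*-assoc (½ ^ n) r v) (trans (cong (λ z → ½ ^ n * z) eq) (*-identityʳ (½ ^ n)))
    rhs : ∀ n → ½ ^ n * r * 2ℚ ^ n ≡ r
    rhs n = begin
      ½ ^ n * r * 2ℚ ^ n     ≡⟨ solve 3 (λ a b c → a :* b :* c := (a :* c) :* b) refl (½ ^ n) r (2ℚ ^ n) ⟩
      ½ ^ n * 2ℚ ^ n * r     ≡⟨ cong (λ z → z * r) (½ⁿ2ⁿ≡1 n) ⟩
      1ℚ * r                 ≡⟨ *-identityˡ r ⟩
      r                      ∎

  root-gap : ∀ n → ∃[ ε ] 0ℚ < ε × (1ℚ + ε) ^ n ≤ 2ℚ
  root-gap n with M n | 0≤M n | linear n
    where
    M : ℕ → ℚ
    M zero    = 0ℚ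
    M (suc n) = 2ℚ * M n + 1ℚ
    0≤M : ∀ n → 0ℚ ≤ M n
    0≤M zero    = ≤-refl
    0≤M (suc n) = +-mono-≤ {0ℚ} {2ℚ * M n} {0ℚ} {1ℚ} (*-nonNeg (<⇒≤ 0<2) (0≤M n)) (<⇒≤ 0<1)
    linear : ∀ n {ε} → 0ℚ ≤ ε → ε ≤ 1ℚ → (1ℚ + ε) ^ n ≤ 1ℚ + M n * ε
    linear zero {ε} 0≤ε ε≤1 = ≤-reflexive (sym (trans (cong (λ z → 1ℚ + z) (*-zeroˡ ε)) (+-identityʳ 1ℚ)))
    linear (suc n) {ε} 0≤ε ε≤1 = begin
      (1ℚ + ε) * (1ℚ + ε) ^ n      ≤⟨ *-monoˡ-≤ (+-mono-≤ {0ℚ} {1ℚ} {0ℚ} {ε} (<⇒≤ 0<1) 0≤ε) (linear n 0≤ε ε≤1) ⟩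
      (1ℚ + ε) * (1ℚ + M n * ε)
        ≡⟨ solve 2 (λ m d → (con 1ℚ :+ d) :* (con 1ℚ :+ m :* d)
                          := con 1ℚ :+ d :+ m :* d :+ (m :* d) :* d) refl (M n) ε ⟩
      1ℚ + ε + M n * ε + (M n * ε) * ε
        ≤⟨ +-monoʳ-≤ (1ℚ + ε + M n * ε) (*-monoˡ-≤ (*-nonNeg (0≤M n) 0≤ε) ε≤1) ⟩
      1ℚ + ε + M n * ε + (M n * ε) * 1ℚ
        ≡⟨ solve 2 (λ m d → con 1ℚ :+ d :+ m :* d :+ (m :* d) :* con 1ℚ
                          := con 1ℚ :+ (con 2ℚ :* m :+ con 1ℚ) :* d) refl (M n) ε ⟩
      1ℚ + (2ℚ * M n + 1ℚ) * ε     ∎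
      where open ≤-Reasoning
  ... | m | 0≤m | lin with recip (<-≤-trans 0<1 (≤-trans (≤-reflexive (sym (+-identityˡ 1ℚ))) (+-monoˡ-≤ 1ℚ 0≤m)))
  ... | ε , 0<ε , eq = ε , 0<ε , ≤-trans (lin (<⇒≤ 0<ε) ε≤1) (+-monoʳ-≤ 1ℚ mε≤1)
    where
    eq' : m * ε + ε ≡ 1ℚ
    eq' = trans (solve 2 (λ m d → m :* d :+ d := (m :+ con 1ℚ) :* d) refl m ε) eq
    mε≤1 : m * ε ≤ 1ℚ
    mε≤1 = subst (m * ε ≤_) eq' (<⇒≤ (<-+ 0<ε))
    ε≤1 : ε ≤ 1ℚ
    ε≤1 = subst₂ _≤_ (+-identityˡ ε) eq' (+-monoˡ-≤ ε (*-nonNeg 0≤m (<⇒≤ 0<ε)))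

  pow2-pos : ∀ a → 0ℚ < pow2 a
  pow2-pos (+ n)    = ^-pos n 0<2
  pow2-pos -[1+ n ] = ^-pos (suc n) 0<½

  pow2-suc : ∀ a → pow2 (ℤ.suc a) ≡ 2ℚ * pow2 a
  pow2-suc (+ n) = refl
  pow2-suc -[1+ zero ] = refl
  pow2-suc -[1+ suc n ] = trans (sym (*-identityˡ (½ ^ suc n))) (*-assoc 2ℚ ½ (½ ^ suc n))

  pow2-^ : ∀ a d → pow2 (a ℤ.* + d) ≡ pow2 a ^ d
  pow2-^ (+ n) d = trans (cong pow2 (sym (ℤ.pos-* n d))) (sym (^-assocʳ 2ℚ n d))
  pow2-^ -[1+ n ] zero = cong pow2 (ℤ.*-zeroʳ -[1+ n ])
  pow2-^ -[1+ n ] (suc d) = sym (^-assocʳ ½ (suc n) (suc d))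

  pow2-< : ∀ a → pow2 a < pow2 (ℤ.suc a)
  pow2-< a = subst₂ _<_ (*-identityˡ (pow2 a)) (sym (pow2-suc a))
    (*-monoˡ-<-pos (pow2 a) {{positive (pow2-pos a)}} 1<2)

  pow2-mono-≤ : ∀ {a b} → a ℤ.≤ b → pow2 a ≤ pow2 b
  pow2-mono-≤ {a} {b} a≤b = subst (λ z → pow2 a ≤ pow2 z) eq (go ℤ.∣ b ℤ.- a ∣)
    where
    go : ∀ n → pow2 a ≤ pow2 (+ n ℤ.+ a)
    go zero    = ≤-reflexive (cong pow2 (sym (ℤ.+-identityˡ a)))
    go (suc n) = ≤-trans (go n) (subst (λ z → pow2 (+ n ℤ.+ a) ≤ pow2 z)
      (sym (ℤ.+-assoc (+ 1) (+ n) a)) (<⇒≤ (pow2-< (+ n ℤ.+ a))))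
    eq : + ℤ.∣ b ℤ.- a ∣ ℤ.+ a ≡ b
    eq = trans (cong (ℤ._+ a) (ℤ.0≤i⇒+∣i∣≡i (ℤ.i≤j⇒0≤j-i a≤b)))
      (trans (ℤ.+-assoc b (ℤ.- a) a)
      (trans (cong (ℤ._+_ b) (ℤ.+-inverseˡ a)) (ℤ.+-identityʳ b)))

  pow2-small : ∀ {r} → 0ℚ < r → ∃[ n ] pow2 -[1+ n ] < r
  pow2-small {r} 0<r =
    let (n , h) = ½^-small 0<r
    in n , <-trans (subst (λ z → ½ * ½ ^ n < z) (*-identityˡ (½ ^ n))
             (*-monoˡ-<-pos (½ ^ n) {{positive (^-pos n 0<½)}} {½} {1ℚ} ½<1)) h

  -- pow2 c < rᵈ says c/d < lg r, and the fraction may be replaced by a smaller one.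
  lower-shift : ∀ {r a c} b d .{{_ : ℕ.NonZero b}} → 0ℚ < r →
                a ℤ.* + d ℤ.≤ c ℤ.* + b → pow2 c < r ^ d → pow2 a < r ^ b
  lower-shift {r} {a} {c} b d 0<r ad≤cb h = ^-cancel-< d (<⇒≤ (^-pos b 0<r)) (begin-strict
    pow2 a ^ d          ≡⟨ pow2-^ a d ⟨
    pow2 (a ℤ.* + d)    ≤⟨ pow2-mono-≤ ad≤cb ⟩
    pow2 (c ℤ.* + b)    ≡⟨ pow2-^ c b ⟩
    pow2 c ^ b          <⟨ ^-mono-< b (pow2-pos c) h ⟩
    (r ^ d) ^ b         ≡⟨ ^-assocʳ r d b ⟩
    r ^ (d ℕ.* b)       ≡⟨ cong (r ^_) (ℕ.*-comm d b) ⟩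
    r ^ (b ℕ.* d)       ≡⟨ ^-assocʳ r b d ⟨
    (r ^ b) ^ d         ∎)
    where open ≤-Reasoning

  upper-shift : ∀ {r a c} b d .{{_ : ℕ.NonZero b}} → 0ℚ < r →
                c ℤ.* + b ℤ.≤ a ℤ.* + d → r ^ d < pow2 c → r ^ b < pow2 a
  upper-shift {r} {a} {c} b d 0<r cb≤ad h = ^-cancel-< d (<⇒≤ (pow2-pos a)) (begin-strict
    (r ^ b) ^ d         ≡⟨ ^-assocʳ r b d ⟩
    r ^ (b ℕ.* d)       ≡⟨ cong (r ^_) (ℕ.*-comm b d) ⟩
    r ^ (d ℕ.* b)       ≡⟨ ^-assocʳ r d b ⟨
    (r ^ d) ^ b         <⟨ ^-mono-< b (^-pos d 0<r) h ⟩
    pow2 c ^ b          ≡⟨ pow2-^ c b ⟨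
    pow2 (c ℤ.* + b)    ≤⟨ pow2-mono-≤ cb≤ad ⟩
    pow2 (a ℤ.* + d)    ≡⟨ pow2-^ a d ⟩
    pow2 a ^ d          ∎)
    where open ≤-Reasoning

  *-monoʳ-< : ∀ {r p q} → 0ℚ < r → p < q → p * r < q * r
  *-monoʳ-< {r} 0<r = *-monoˡ-<-pos r {{positive 0<r}}

  *-cancelʳ-< : ∀ {r p q} → 0ℚ < r → p * r < q * r → p < q
  *-cancelʳ-< {r} 0<r = *-cancelʳ-<-nonNeg r {{nonNegative (<⇒≤ 0<r)}}

  divide : ∀ c {r} → 0ℚ < r → ∃[ q ] q * r ≡ c
  divide c {r} 0<r =
    let (s , _ , rs≡1) = recip 0<r
    in c * s , trans (*-assoc c s r) (trans (cong (c *_) (trans (*-comm s r) rs≡1)) (*-identityʳ c))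

  unit-≤-½ : ∀ m → + 1 / suc (suc m) ≤ ½
  unit-≤-½ m = toℚᵘ-cancel-≤ (ℚᵘ.≤-respˡ-≃ (ℚᵘ.≃-sym (toℚᵘ-/ (+ 1) (suc (suc m))))
    (ℚᵘ.*≤* (ℤ.+≤+ (ℕ.s≤s (ℕ.s≤s ℕ.z≤n)))))

  tail-step : ∀ E f g → g ≤ ½ * f → E + f + (g + g) ≤ E + (f + f)
  tail-step E f g g≤½f = subst (E + f + (g + g) ≤_)
    (trans (cong (λ z → E + f + z) (trans (sym (*-distribʳ-+ f ½ ½)) (*-identityˡ f))) (+-assoc E f f))
    (+-monoʳ-≤ (E + f) {g + g} {½ * f + ½ * f} (+-mono-≤ {g} {½ * f} {g} {½ * f} g≤½f g≤½f))

  add-gap : ∀ E p d q → E ≤ p → d < q - p → E + d < q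
  add-gap E p d q E≤p d<q-p = ≤-<-trans (+-monoˡ-≤ d {E} {p} E≤p)
    (subst (p + d <_) (solve 2 (λ p q → p :+ (q :- p) := q) refl p q) (+-monoʳ-< p {d} {q - p} d<q-p))

  lower-/ : ∀ {r} a b .{{_ : ℕ.NonZero b}} → 0ℚ < r → pow2 a < r ^ b → pow2 (↥ (a / b)) < r ^ ↧ₙ (a / b)
  lower-/ {r} a b 0<r = lower-shift {r} {↥ (a / b)} {a} (↧ₙ (a / b)) b 0<r (ℤ.≤-reflexive (cross-/ a b))

  upper-/ : ∀ {r} a b .{{_ : ℕ.NonZero b}} → 0ℚ < r → r ^ b < pow2 a → r ^ ↧ₙ (a / b) < pow2 (↥ (a / b))
  upper-/ {r} a b 0<r = upper-shift {r} {↥ (a / b)} {a} (↧ₙ (a / b)) b 0<r (ℤ.≤-reflexive (sym (cross-/ a b)))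

  i<1+i : ∀ i → i ℤ.< ℤ.suc i
  i<1+i i = ℤ.suc[i]≤j⇒i<j ℤ.≤-refl

  scale : ∀ a b n → a ℤ.* + (b ℕ.* n) ≡ a ℤ.* + n ℤ.* + b
  scale a b n = trans (cong (a ℤ.*_) (trans (ℤ.pos-* b n) (ℤ.*-comm (+ b) (+ n)))) (sym (ℤ.*-assoc a (+ n) (+ b)))

  lower-open : ∀ {r} p → 0ℚ < r → pow2 (↥ p) < r ^ ↧ₙ p →
               ∃[ q ] p < q × pow2 (↥ q) < r ^ ↧ₙ q
  lower-open {r} p 0<r h =
    let (n , 2s<t) = ^-ratio (pow2-pos (↥ p)) h
    in finer n , p<finer n , lower-/ (num n) (den n) 0<r (subst₂ _<_ (lhs n) (^-assocʳ r (↧ₙ p) (suc n)) 2s<t)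
    where
    num : ℕ → ℤ
    num n = ℤ.suc (↥ p ℤ.* + suc n)
    den : ℕ → ℕ
    den n = ↧ₙ p ℕ.* suc n
    finer : ℕ → ℚ
    finer n = num n / den n
    lhs : ∀ n → 2ℚ * pow2 (↥ p) ^ suc n ≡ pow2 (num n)
    lhs n = trans (cong (λ z → 2ℚ * z) (sym (pow2-^ (↥ p) (suc n)))) (sym (pow2-suc (↥ p ℤ.* + suc n)))
    p<finer : ∀ n → p < finer n
    p<finer n = </ {p} {num n} {den n} (subst (ℤ._< num n ℤ.* ↧ p) (sym (scale (↥ p) (↧ₙ p) (suc n)))
      (ℤ.*-monoʳ-<-pos (↧ p) (i<1+i (↥ p ℤ.* + suc n))))

  upper-open : ∀ {r} q → 0ℚ < r → r ^ ↧ₙ q < pow2 (↥ q) →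
               ∃[ p ] p < q × r ^ ↧ₙ p < pow2 (↥ p)
  upper-open {r} q 0<r h =
    let (n , 2s<t) = ^-ratio (^-pos (↧ₙ q) 0<r) h
    in finer n , finer<q n , upper-/ (num n) (den n) 0<r
         (subst (_< pow2 (num n)) (^-assocʳ r (↧ₙ q) (suc n))
           (*-cancelˡ-<-nonNeg 2ℚ {(r ^ ↧ₙ q) ^ suc n} {pow2 (num n)}
             (subst (2ℚ * (r ^ ↧ₙ q) ^ suc n <_) (rhs n) 2s<t)))
    where
    num : ℕ → ℤ
    num n = ℤ.pred (↥ q ℤ.* + suc n)
    den : ℕ → ℕ
    den n = ↧ₙ q ℕ.* suc n
    finer : ℕ → ℚ
    finer n = num n / den n
    rhs : ∀ n → pow2 (↥ q) ^ suc n ≡ 2ℚ * pow2 (num n)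
    rhs n = trans (sym (pow2-^ (↥ q) (suc n)))
      (trans (cong pow2 (sym (ℤ.suc-pred (↥ q ℤ.* + suc n)))) (pow2-suc (num n)))
    finer<q : ∀ n → finer n < q
    finer<q n = /< {q} {num n} {den n} (subst (num n ℤ.* ↧ q ℤ.<_) (sym (scale (↥ q) (↧ₙ q) (suc n)))
      (ℤ.*-monoʳ-<-pos (↧ q) (subst (num n ℤ.<_) (ℤ.suc-pred (↥ q ℤ.* + suc n)) (i<1+i (num n)))))

  lg-locate : ∀ {l d ε} p q → p < q → 0ℚ < l → 0ℚ < l + d → 0ℚ < ε → d < l * ε →
              (1ℚ + ε) ^ (↧ₙ p ℕ.* ↧ₙ q) ≤ 2ℚ →
              pow2 (↥ p) < l ^ ↧ₙ p ⊎ (l + d) ^ ↧ₙ q < pow2 (↥ q)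
  lg-locate {l} {d} {ε} p q p<q 0<l 0<u 0<ε d<lε gap = go (pow2 A <? l ^ N)
    where
    open ≤-Reasoning
    N = ↧ₙ p ℕ.* ↧ₙ q
    A = ↥ p ℤ.* ↧ q
    C = ↥ q ℤ.* ↧ p
    u<l[1+ε] : l + d < l * (1ℚ + ε)
    u<l[1+ε] = subst (l + d <_)
      (trans (cong (λ z → z + l * ε) (sym (*-identityʳ l))) (sym (*-distribˡ-+ l 1ℚ ε)))
      (+-monoʳ-< l {d} {l * ε} d<lε)
    eqA : ↥ p ℤ.* + N ≡ A ℤ.* + ↧ₙ p
    eqA = scale (↥ p) (↧ₙ p) (↧ₙ q)
    eqC : C ℤ.* + ↧ₙ q ≡ ↥ q ℤ.* + N
    eqC = trans (sym (scale (↥ q) (↧ₙ q) (↧ₙ p))) (cong (λ z → ↥ q ℤ.* + z) (ℕ.*-comm (↧ₙ q) (↧ₙ p)))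
    go : Dec (pow2 A < l ^ N) → _
    go (yes h) = inj₁ (lower-shift {l} {↥ p} {A} (↧ₙ p) N 0<l (ℤ.≤-reflexive eqA) h)
    go (no ¬h) = inj₂ (upper-shift {l + d} {↥ q} {C} (↧ₙ q) N 0<u (ℤ.≤-reflexive eqC) (begin-strict
      (l + d) ^ N             <⟨ ^-mono-< N 0<u u<l[1+ε] ⟩
      (l * (1ℚ + ε)) ^ N      ≡⟨ ^-distrib-* l (1ℚ + ε) N ⟩
      l ^ N * (1ℚ + ε) ^ N    ≤⟨ *-monoˡ-≤ {l ^ N} (<⇒≤ (^-pos N 0<l)) gap ⟩
      l ^ N * 2ℚ              ≤⟨ *-monoʳ-≤ {2ℚ} {l ^ N} {pow2 A} (<⇒≤ 0<2) (≮⇒≥ ¬h) ⟩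
      pow2 A * 2ℚ             ≡⟨ trans (*-comm (pow2 A) 2ℚ) (sym (pow2-suc A)) ⟩
      pow2 (ℤ.suc A)          ≤⟨ pow2-mono-≤ (ℤ.i<j⇒suc[i]≤j (drop-*<* p<q)) ⟩
      pow2 C                  ∎))

open RationalLemmas

record ℝ : Set₁ where
  field
    L U         : ℚ → Set
    L-inhabited : ∃ L
    U-inhabited : ∃ U
    L-down      : ∀ {p q} → p < q → L q → L p
    U-up        : ∀ {p q} → p < q → U p → U q
    L-open      : ∀ {p} → L p → ∃[ q ] p < q × L q
    U-open      : ∀ {q} → U q → ∃[ p ] p < q × U p
    disjoint    : ∀ {q} → L q → U q → ⊥
    located     : ∀ {p q} → p < q → L p ⊎ U q

  L<U : ∀ {p q} → L p → U q → p < q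
  L<U {p} {q} Lp Uq with <-cmp p q
  ... | tri< p<q _ _    = p<q
  ... | tri≈ _ refl _   = ⊥-elim (disjoint Lp Uq)
  ... | tri> _ _ q<p    = ⊥-elim (disjoint (L-down q<p Lp) Uq)

  approx : ∀ {l h} → L l → 0ℚ < h → ∃[ m ] l ≤ m × L m × U (m + (h + h))
  approx {l} {h} Ll 0<h = walk steps l Ll covers
    where
    open ≤-Reasoning
    open +-*-Solver
    u = proj₁ U-inhabited
    h⁻¹ = proj₁ (recip 0<h)
    steps = proj₁ (archimedean ((u - l) * h⁻¹))
    covers : u ≤ l + nat steps * h
    covers = begin
      u                         ≡⟨ solve 2 (λ a b → a := b :+ (a :- b) :* con 1ℚ) refl u l ⟩
      l + (u - l) * 1ℚ          ≡⟨ cong (λ z → l + (u - l) * z) (trans (*-comm h⁻¹ h) (proj₂ (proj₂ (recip 0<h)))) ⟨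
      l + (u - l) * (h⁻¹ * h)   ≡⟨ cong (λ z → l + z) (*-assoc (u - l) h⁻¹ h) ⟨
      l + (u - l) * h⁻¹ * h
        ≤⟨ +-monoʳ-≤ l {(u - l) * h⁻¹ * h} {nat steps * h}
             (*-monoʳ-≤ {h} (<⇒≤ 0<h) (<⇒≤ (proj₂ (archimedean ((u - l) * h⁻¹))))) ⟩
      l + nat steps * h         ∎
    walk : ∀ n l → L l → u ≤ l + nat n * h → ∃[ m ] l ≤ m × L m × U (m + (h + h))
    walk zero l Ll u≤ = ⊥-elim (<-irrefl refl (<-≤-trans (L<U Ll (proj₂ U-inhabited))
      (subst (u ≤_) (trans (cong (λ z → l + z) (*-zeroˡ h)) (+-identityʳ l)) u≤)))
    walk (suc n) l Ll u≤ = next (located (<-+ {l + h} {h} 0<h))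
      where
      next : L (l + h) ⊎ U (l + h + h) → ∃[ m ] l ≤ m × L m × U (m + (h + h))
      next (inj₂ U') = l , ≤-refl , Ll , subst U (+-assoc l h h) U'
      next (inj₁ L') =
        let (m , l+h≤m , rest) = walk n (l + h) L' (subst (u ≤_)
              (trans (cong (λ z → l + z * h) (nat-suc n))
                (solve 3 (λ a b c → a :+ (con 1ℚ :+ b) :* c := a :+ c :+ b :* c) refl l (nat n) h)) u≤)
        in m , ≤-trans (<⇒≤ (<-+ {l} {h} 0<h)) l+h≤m , rest

open ℝ using (L; U)

infix 4 _≤ℝ_

_≤ℝ_ : ℝ → ℝ → Set
x ≤ℝ y = ∀ q → L x q → L y q

fromℚ : ℚ → ℝ
fromℚ c = record
  { L = _< c
  ; U = c <_
  ; L-inhabited = c - 1ℚ , c-1<c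
  ; U-inhabited = c + 1ℚ , <-+ {c} {1ℚ} 0<1
  ; L-down = <-trans
  ; U-up = λ p<q c<p → <-trans c<p p<q
  ; L-open = λ p<c → let (m , p<m , m<c) = <-dense p<c in m , p<m , m<c
  ; U-open = λ c<q → let (m , c<m , m<q) = <-dense c<q in m , m<q , c<m
  ; disjoint = λ q<c c<q → <-asym q<c c<q
  ; located = loc
  }
  where
  c-1<c : c - 1ℚ < c
  c-1<c = subst (c - 1ℚ <_) (+-identityʳ c) (+-monoʳ-< c { - 1ℚ} {0ℚ} (negative⁻¹ (- 1ℚ)))
  loc : ∀ {p q} → p < q → p < c ⊎ c < q
  loc {p} p<q with p <? c
  ... | yes p<c = inj₁ p<c
  ... | no  p≮c = inj₂ (≤-<-trans (≮⇒≥ p≮c) p<q)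

fromℕ : ℕ → ℝ
fromℕ n = fromℚ (nat n)

infix  8 -ℝ_
infixl 6 _+ℝ_ _-ℝ_
infixr 7 _·_

-ℝ_ : ℝ → ℝ
-ℝ x = record
  { L = λ q → U x (- q)
  ; U = λ q → L x (- q)
  ; L-inhabited = - proj₁ x.U-inhabited , subst (U x) (sym (neg² _)) (proj₂ x.U-inhabited)
  ; U-inhabited = - proj₁ x.L-inhabited , subst (L x) (sym (neg² _)) (proj₂ x.L-inhabited)
  ; L-down = λ p<q → x.U-up (neg-antimono-< p<q)
  ; U-up = λ p<q → x.L-down (neg-antimono-< p<q)
  ; L-open = λ {p} u → let (r , r<-p , Ur) = x.U-open u in
      - r , subst (_< - r) (neg² p) (neg-antimono-< r<-p) , subst (U x) (sym (neg² r)) Ur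
  ; U-open = λ {q} l → let (r , -q<r , Lr) = x.L-open l in
      - r , subst (- r <_) (neg² q) (neg-antimono-< -q<r) , subst (L x) (sym (neg² r)) Lr
  ; disjoint = λ u l → x.disjoint l u
  ; located = λ p<q → swap (x.located (neg-antimono-< p<q))
  }
  where
  module x = ℝ x
  open +-*-Solver
  neg² : ∀ q → - (- q) ≡ q
  neg² q = solve 1 (λ a → :- (:- a) := a) refl q

-- r + s = q is expressed by taking s = q - r.
_+ℝ_ : ℝ → ℝ → ℝ
x +ℝ y = record
  { L = λ q → ∃[ r ] L x r × L y (q - r)
  ; U = λ q → ∃[ r ] U x r × U y (q - r)
  ; L-inhabited = inh x.L-inhabited y.L-inhabited
  ; U-inhabited = inh x.U-inhabited y.U-inhabited
  ; L-down = λ {p} {q} p<q (r , Lr , Ls) → r , Lr , y.L-down (+-monoˡ-< (- r) p<q) Ls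
  ; U-up = λ {p} {q} p<q (r , Ur , Us) → r , Ur , y.U-up (+-monoˡ-< (- r) p<q) Us
  ; L-open = λ {p} (r , Lr , Ls) → let (t , s<t , Lt) = y.L-open Ls in
      r + t , subst (_< r + t) (cancel₂ r p) (+-monoʳ-< r {p - r} {t} s<t) ,
      r , Lr , subst (L y) (sym (cancel r t)) Lt
  ; U-open = λ {q} (r , Ur , Us) → let (t , t<s , Ut) = y.U-open Us in
      r + t , subst (r + t <_) (cancel₂ r q) (+-monoʳ-< r {t} {q - r} t<s) ,
      r , Ur , subst (U y) (sym (cancel r t)) Ut
  ; disjoint = λ {q} (r , Lr , Ls) (r' , Ur' , Us') →
      <-asym (+-monoʳ-< q { - r'} { - r} (neg-antimono-< (x.L<U Lr Ur'))) (y.L<U Ls Us')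
  ; located = loc
  }
  where
  module x = ℝ x
  module y = ℝ y
  open +-*-Solver
  cancel : ∀ r t → r + t - r ≡ t
  cancel r t = solve 2 (λ a b → a :+ b :- a := b) refl r t
  cancel₂ : ∀ r p → r + (p - r) ≡ p
  cancel₂ r p = solve 2 (λ a b → a :+ (b :- a) := b) refl r p
  inh : ∀ {P Q : ℚ → Set} → ∃ P → ∃ Q → ∃[ q ] ∃[ r ] P r × Q (q - r)
  inh {Q = Q} (r , Pr) (s , Qs) = r + s , r , Pr , subst Q (sym (cancel r s)) Qs
  loc : ∀ {p q} → p < q → (∃[ r ] L x r × L y (p - r)) ⊎ (∃[ r ] U x r × U y (q - r))
  loc {p} {q} p<q = from-halves (halve (diff-pos p<q))
    where
    split : ∀ l d → L x l → U x (l + d) → L y (p - l) ⊎ U y (q - (l + d)) → _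
    split l d Ll Uu (inj₁ Lp) = inj₁ (l , Ll , Lp)
    split l d Ll Uu (inj₂ Uq) = inj₂ (l + d , Uu , Uq)
    from-halves : (∃[ h ] 0ℚ < h × h + h < q - p) → _
    from-halves (h , 0<h , 2h<q-p) =
      let (l , _ , Ll , Uu) = x.approx (proj₂ x.L-inhabited) 0<h
      in split l (h + h) Ll Uu (y.located (shift-gap p q l (h + h) 2h<q-p))

_-ℝ_ : ℝ → ℝ → ℝ
x -ℝ y = x +ℝ (-ℝ y)

_·_ : ℕ → ℝ → ℝ
zero  · x = fromℕ 0
suc n · x = x +ℝ (n · x)

record ℝ⁺ : Set₁ where
  field
    real : ℝ
    0∈L  : L real 0ℚ

  U-pos : ∀ {r} → U real r → 0ℚ < r
  U-pos = ℝ.L<U real 0∈L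

  L-pos : ∃[ r ] 0ℚ < r × L real r
  L-pos = ℝ.L-open real 0∈L

open ℝ⁺ using (real)

fromℕ⁺ : ∀ k .{{_ : ℕ.NonZero k}} → ℝ⁺
fromℕ⁺ k = record { real = fromℕ k ; 0∈L = nat-pos k }

infixl 8 _÷ℝ_

-- q < k/y iff q r < k for some r > y; q > k/y iff q r > k for some r in (0,y).
_÷ℝ_ : ∀ k .{{_ : ℕ.NonZero k}} → ℝ⁺ → ℝ⁺
k ÷ℝ y = record
  { real = record
    { L = λ q → ∃[ r ] U x r × q * r < c
    ; U = λ q → ∃[ r ] 0ℚ < r × L x r × c < q * r
    ; L-inhabited = 0ℚ , zero∈L x.U-inhabited
    ; U-inhabited = U-inh y.L-pos
    ; L-down = λ {p} {q} p<q (r , Ur , qr<c) →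
        r , Ur , <-trans (*-monoʳ-< {r} {p} {q} (y.U-pos Ur) p<q) qr<c
    ; U-up = λ {p} {q} p<q (r , 0<r , Lr , c<pr) →
        r , 0<r , Lr , <-trans c<pr (*-monoʳ-< {r} {p} {q} 0<r p<q)
    ; L-open = λ {p} (r , Ur , pr<c) →
        let (m , pr<m , m<c) = <-dense pr<c
            (q , qr≡m)       = divide m (y.U-pos Ur)
        in q , *-cancelʳ-< {r} {p} {q} (y.U-pos Ur) (subst (p * r <_) (sym qr≡m) pr<m) ,
           r , Ur , subst (_< c) (sym qr≡m) m<c
    ; U-open = λ {q} (r , 0<r , Lr , c<qr) →
        let (m , c<m , m<qr) = <-dense c<qr
            (p , pr≡m)       = divide m 0<r
        in p , *-cancelʳ-< {r} {p} {q} 0<r (subst (_< q * r) (sym pr≡m) m<qr) ,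
           r , 0<r , Lr , subst (c <_) (sym pr≡m) c<m
    ; disjoint = λ {q} (r , Ur , qr<c) (s , 0<s , Ls , c<qs) →
        let 0<q = *-cancelʳ-< {s} {0ℚ} {q} 0<s
                    (subst (_< q * s) (sym (*-zeroˡ s)) (<-trans 0<c c<qs))
        in <-asym (<-trans c<qs (*-monoˡ-< {q} {s} {r} 0<q (x.L<U Ls Ur))) qr<c
    ; located = λ {p} {q} p<q → loc p q p<q (0ℚ <? p)
    }
  ; 0∈L = zero∈L x.U-inhabited
  }
  where
  x = real y
  module x = ℝ x
  module y = ℝ⁺ y
  c = nat k
  0<c = nat-pos k
  QL QU : ℚ → Set
  QL q = ∃[ r ] U x r × q * r < c
  QU q = ∃[ r ] 0ℚ < r × L x r × c < q * r
  zero∈L : ∃ (U x) → QL 0ℚ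
  zero∈L (r , Ur) = r , Ur , subst (_< c) (sym (*-zeroˡ r)) 0<c
  U-inh : (∃[ r ] 0ℚ < r × L x r) → ∃ QU
  U-inh (r , 0<r , Lr) =
    let (q , qr≡c+1) = divide (c + 1ℚ) 0<r
    in q , r , 0<r , Lr , subst (c <_) (sym qr≡c+1) (<-+ {c} {1ℚ} 0<1)
  loc : ∀ p q → p < q → Dec (0ℚ < p) → QL p ⊎ QU q
  loc p q p<q (no 0≮p) = inj₁ (let (r , Ur) = x.U-inhabited in
    r , Ur , ≤-<-trans (subst (p * r ≤_) (*-zeroˡ r) (*-monoʳ-≤ {r} {p} {0ℚ} (<⇒≤ (y.U-pos Ur)) (≮⇒≥ 0≮p))) 0<c)
  loc p q p<q (yes 0<p) =
    let (s , sq≡c) = divide c 0<q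
        (t , tp≡c) = divide c 0<p
        0<s        = *-cancelʳ-< {q} {0ℚ} {s} 0<q (subst₂ _<_ (sym (*-zeroˡ q)) (sym sq≡c) 0<c)
        sp<tp      = subst₂ _<_ refl (trans sq≡c (sym tp≡c)) (*-monoˡ-< {s} {p} {q} 0<s p<q)
    in from-x s t 0<s sq≡c tp≡c (x.located (*-cancelʳ-< {p} {s} {t} 0<p sp<tp))
    where
    0<q = <-trans 0<p p<q
    from-x : ∀ s t → 0ℚ < s → s * q ≡ c → t * p ≡ c → L x s ⊎ U x t → QL p ⊎ QU q
    from-x s t 0<s sq≡c tp≡c (inj₁ Ls) = inj₂ (let (r , s<r , Lr) = x.L-open Ls in
      r , <-trans 0<s s<r , Lr ,
      subst (_< q * r) (trans (*-comm q s) sq≡c) (*-monoˡ-< {q} {s} {r} 0<q s<r))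
    from-x s t 0<s sq≡c tp≡c (inj₂ Ut) = inj₁ (let (r , r<t , Ur) = x.U-open Ut in
      r , Ur ,
      subst (p * r <_) (trans (*-comm p t) tp≡c) (*-monoˡ-< {p} {r} {t} 0<p r<t))

invFact : ℕ → ℚ
invFact m = (+ 1 / m !) {{m ℕ.!≢0}}

expSum : ℕ → ℚ
expSum zero    = 0ℚ
expSum (suc m) = expSum m + invFact m

module ExpSumLemmas where

  invFact-pos : ∀ m → 0ℚ < invFact m
  invFact-pos m = positive⁻¹ (invFact m) {{normalize-pos 1 (m !) {{m ℕ.!≢0}}}}

  invFact-halves : ∀ m → invFact (suc (suc m)) ≤ ½ * invFact (suc m)
  invFact-halves m = subst (_≤ ½ * invFact (suc m))
    (/-*-/ (+ 1) (suc (suc m)) (+ 1) (suc m !) {{_}} {{suc m ℕ.!≢0}} {{suc (suc m) ℕ.!≢0}})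
    (*-monoʳ-≤ {invFact (suc m)} {+ 1 / suc (suc m)} {½} (<⇒≤ (invFact-pos (suc m))) (unit-≤-½ m))

  invFact≤½^ : ∀ m → invFact (suc m) ≤ ½ ^ m
  invFact≤½^ zero    = ≤-refl
  invFact≤½^ (suc m) = ≤-trans (invFact-halves m) (*-monoˡ-≤ {½} {invFact (suc m)} {½ ^ m} (<⇒≤ 0<½) (invFact≤½^ m))

  expSum-mono : ∀ n j → expSum n ≤ expSum (j ℕ.+ n)
  expSum-mono n zero    = ≤-refl
  expSum-mono n (suc j) = ≤-trans (expSum-mono n j)
    (<⇒≤ (<-+ {expSum (j ℕ.+ n)} {invFact (j ℕ.+ n)} (invFact-pos (j ℕ.+ n))))

  bound : ℕ → ℚ
  bound m = expSum m + (invFact m + invFact m)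

  bound-step : ∀ m → bound (suc (suc m)) ≤ bound (suc m)
  bound-step m = tail-step (expSum (suc m)) (invFact (suc m)) (invFact (suc (suc m))) (invFact-halves m)

  bound-anti : ∀ m j → bound (j ℕ.+ suc m) ≤ bound (suc m)
  bound-anti m zero    = ≤-refl
  bound-anti m (suc j) = ≤-trans
    (subst (λ i → bound (suc i) ≤ bound i) (sym (ℕ.+-suc j m)) (bound-step (j ℕ.+ m)))
    (bound-anti m j)

  expSum≤bound : ∀ m n → expSum n ≤ bound (suc m)
  expSum≤bound m n = ≤-trans (subst (λ i → expSum n ≤ expSum i) (ℕ.+-comm (suc m) n) (expSum-mono n (suc m)))
    (≤-trans (<⇒≤ (<-+ {expSum i} {invFact i + invFact i} (<-trans (invFact-pos i) (<-+ {invFact i} (invFact-pos i)))))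
             (bound-anti m n))
    where i = n ℕ.+ suc m

  invFact-small : ∀ {δ} → 0ℚ < δ → ∃[ m ] invFact (suc m) + invFact (suc m) < δ
  invFact-small {δ} 0<δ =
    let (h , 0<h , 2h<δ) = halve 0<δ
        (m , ½ᵐ<h)       = ½^-small 0<h
        f<h              = ≤-<-trans (invFact≤½^ m) ½ᵐ<h
    in m , <-trans (+-mono-< {invFact (suc m)} {h} {invFact (suc m)} {h} f<h f<h) 2h<δ

open ExpSumLemmas

-- The supremum of the partial sums of Σ 1/i!.
e : ℝ⁺
e = record
  { real = record
    { L = eL
    ; U = eU
    ; L-inhabited = 0ℚ , zero∈L
    ; U-inhabited = bound 1 + 1ℚ , bound 1 , <-+ {bound 1} {1ℚ} 0<1 , expSum≤bound 0
    ; L-down = λ p<q (m , q<E) → m , <-trans p<q q<E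
    ; U-up = λ p<q (r , r<p , E≤r) → r , <-trans r<p p<q , E≤r
    ; L-open = λ (m , p<E) → let (q , p<q , q<E) = <-dense p<E in q , p<q , m , q<E
    ; U-open = λ (r , r<q , E≤r) → let (p , r<p , p<q) = <-dense r<q in p , p<q , r , r<p , E≤r
    ; disjoint = λ (m , q<E) (r , r<q , E≤r) → <-asym r<q (<-≤-trans q<E (E≤r m))
    ; located = loc
    }
  ; 0∈L = zero∈L
  }
  where
  eL eU : ℚ → Set
  eL q = ∃[ m ] q < expSum m
  eU q = ∃[ r ] r < q × (∀ m → expSum m ≤ r)
  zero∈L : eL 0ℚ
  zero∈L = 1 , 0<1
  loc : ∀ {p q} → p < q → eL p ⊎ eU q
  loc {p} {q} p<q = from-small (invFact-small (diff-pos p<q))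
    where
    from-small : (∃[ m ] invFact (suc m) + invFact (suc m) < q - p) → eL p ⊎ eU q
    from-small (m , small) with p <? expSum (suc m)
    ... | yes p<E = inj₁ (suc m , p<E)
    ... | no  p≮E = inj₂ (bound (suc m) ,
      add-gap (expSum (suc m)) p (invFact (suc m) + invFact (suc m)) q (≮⇒≥ p≮E) small , expSum≤bound m)

-- For q = a/b with b > 0, q < lg x iff 2ᵃ < xᵇ, and q > lg x iff 2ᵃ > xᵇ.
lg : ℝ⁺ → ℝ
lg y = record
  { L = lgL
  ; U = lgU
  ; L-inhabited = L-inh y.L-pos
  ; U-inhabited = U-inh x.U-inhabited
  ; L-down = λ {p} {q} p<q (r , 0<r , Lr , h) →
      r , 0<r , Lr , lower-shift {r} {↥ p} {↥ q} (↧ₙ p) (↧ₙ q) 0<r (ℤ.<⇒≤ (drop-*<* p<q)) h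
  ; U-up = λ {p} {q} p<q (r , Ur , h) →
      r , Ur , upper-shift {r} {↥ q} {↥ p} (↧ₙ q) (↧ₙ p) (y.U-pos Ur) (ℤ.<⇒≤ (drop-*<* p<q)) h
  ; L-open = λ {p} (r , 0<r , Lr , h) →
      let (q , p<q , h′) = lower-open p 0<r h in q , p<q , r , 0<r , Lr , h′
  ; U-open = λ {q} (r , Ur , h) →
      let (p , p<q , h′) = upper-open q (y.U-pos Ur) h in p , p<q , r , Ur , h′
  ; disjoint = λ {q} (r , 0<r , Lr , h) (s , Us , h′) →
      <-asym (<-trans h (^-mono-< (↧ₙ q) 0<r (x.L<U Lr Us))) h′
  ; located = λ {p} {q} p<q → loc p q p<q y.L-pos
  }
  where
  x = real y
  module x = ℝ x
  module y = ℝ⁺ y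
  lgL lgU : ℚ → Set
  lgL q = ∃[ r ] 0ℚ < r × L x r × pow2 (↥ q) < r ^ ↧ₙ q
  lgU q = ∃[ r ] U x r × r ^ ↧ₙ q < pow2 (↥ q)
  L-inh : (∃[ r ] 0ℚ < r × L x r) → ∃ lgL
  L-inh (r , 0<r , Lr) =
    let (n , h) = pow2-small 0<r
    in -[1+ n ] / 1 , r , 0<r , Lr ,
       lower-/ -[1+ n ] 1 0<r (subst (pow2 -[1+ n ] <_) (sym (*-identityʳ r)) h)
  U-inh : ∃ (U x) → ∃ lgU
  U-inh (r , Ur) =
    let (n , h) = ^-unbounded 1<2 r
    in + n / 1 , r , Ur ,
       upper-/ (+ n) 1 (y.U-pos Ur) (subst (_< 2ℚ ^ n) (sym (*-identityʳ r)) h)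
  loc : ∀ p q → p < q → (∃[ r ] 0ℚ < r × L x r) → lgL p ⊎ lgU q
  loc p q p<q (l₀ , 0<l₀ , Ll₀) =
    let (ε , 0<ε , gap)       = root-gap (↧ₙ p ℕ.* ↧ₙ q)
        (h , 0<h , 2h<l₀ε)    = halve (*-pos {l₀} {ε} 0<l₀ 0<ε)
        (l , l₀≤l , Ll , Uu)  = x.approx Ll₀ 0<h
    in from-approx ε 0<ε gap l (h + h) 2h<l₀ε l₀≤l Ll Uu
    where
    from-approx : ∀ ε → 0ℚ < ε → (1ℚ + ε) ^ (↧ₙ p ℕ.* ↧ₙ q) ≤ 2ℚ → ∀ l d → d < l₀ * ε →
                  l₀ ≤ l → L x l → U x (l + d) → lgL p ⊎ lgU q
    from-approx ε 0<ε gap l d d<l₀ε l₀≤l Ll Uu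
      with lg-locate p q p<q (<-≤-trans 0<l₀ l₀≤l) (y.U-pos Uu) 0<ε
             (<-≤-trans d<l₀ε (*-monoʳ-≤ {ε} {l₀} {l} (<⇒≤ 0<ε) l₀≤l)) gap
    ... | inj₁ h = inj₁ (l , <-≤-trans 0<l₀ l₀≤l , Ll , h)
    ... | inj₂ h = inj₂ (l + d , Uu , h)

module _ {n : ℕ} where

  occurrences : Vec ℕ n → Fin n → Fin n → ℕ → ℕ
  occurrences A i j a =
    length (filter (λ t → (i Fin.≤? t) ×-dec (t Fin.≤? j) ×-dec (lookup A t ℕ.≟ a)) (allFin n))

  rangeLength : Fin n → Fin n → ℕ
  rangeLength i j = suc (toℕ j) ℕ.∸ toℕ i

  IsMajority : ℚ → Vec ℕ n → Fin n → Fin n → ℕ → Set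
  IsMajority τ A i j a = τ * nat (rangeLength i j) ≤ nat (occurrences A i j a)

  HasMajority : ℚ → Vec ℕ n → Fin n → Fin n → Set
  HasMajority τ A i j = ∃[ a ] IsMajority τ A i j a

-- Positions are numbered from 0. Since queries only compare entries for equality, ℕ
-- serves as the unrestricted alphabet.
record DecisionEncoding (τ : ℚ) (n : ℕ) : Set where
  field
    encode  : Vec ℕ n → List Bool
    query   : List Bool → Fin n → Fin n → Bool
    correct : ∀ A i j → i Fin.≤ j → query (encode A) i j ≡ true ⇔ HasMajority τ A i j

{-# OPTIONS --safe #-}

-- An array is a fixed gadget of k² entries followed by m permutations of the k symbols 0, …, k−1.
-- After b full permutations every symbol has occurred b times, so a window that starts in the gadget
-- and ends in the current permutation contains each symbol either b or b+1 times beyond the gadget.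
-- For every symbol x the gadget has a suffix of (x+1)k entries holding x exactly x+1 times and every
-- other symbol at most x times.  The window from the start of that suffix to the current position
-- then has a 1/k-majority iff the current entry is x.  Hence two such arrays get different codes,
-- already told apart at their first difference, and some code has length ℓ with (k!)ᵐ < 2^(ℓ+1).
-- Finally k! ≥ (k/e)ᵏ, since (1+1/j)ʲ ≤ e for every j, and n − mk = O(k²).
module Submission where

-- Fractions compared through integers

module Rationals where

  open import Defs using (nat; module RationalLemmas)
  open RationalLemmas using (toℚᵘ-/; /-*-/)
  import Data.Integer.Base as ℤ
  import Data.Integer.Properties as ℤ
  open import Data.Nat.Base using (NonZero; suc; _*_; _≤_)
  open import Data.Nat.Properties using (m*n≢0)
  import Data.Rational.Base as ℚ
  import Data.Rational.Properties as ℚ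
  import Data.Rational.Unnormalised.Base as ℚᵘ
  import Data.Rational.Unnormalised.Properties as ℚᵘ
  open import Relation.Binary.PropositionalEquality

  /-≤-/ : ∀ {a b c d} .{{_ : NonZero b}} .{{_ : NonZero d}} →
          a ℤ.* ℤ.+ d ℤ.≤ c ℤ.* ℤ.+ b → a ℚ./ b ℚ.≤ c ℚ./ d
  /-≤-/ {a} {suc b} {c} {suc d} h = ℚ.toℚᵘ-cancel-≤
    (ℚᵘ.≤-respˡ-≃ (ℚᵘ.≃-sym (toℚᵘ-/ a (suc b))) (ℚᵘ.≤-respʳ-≃ (ℚᵘ.≃-sym (toℚᵘ-/ c (suc d))) (ℚᵘ.*≤* h)))

  /-≤-/⁻¹ : ∀ {a b c d} .{{_ : NonZero b}} .{{_ : NonZero d}} →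
            a ℚ./ b ℚ.≤ c ℚ./ d → a ℤ.* ℤ.+ d ℤ.≤ c ℤ.* ℤ.+ b
  /-≤-/⁻¹ {a} {suc b} {c} {suc d} h = ℚᵘ.drop-*≤*
    (ℚᵘ.≤-respˡ-≃ (toℚᵘ-/ a (suc b)) (ℚᵘ.≤-respʳ-≃ (toℚᵘ-/ c (suc d)) (ℚ.toℚᵘ-mono-≤ h)))

  nat-mono-≤ : ∀ {m n} → m ≤ n → nat m ℚ.≤ nat n
  nat-mono-≤ {m} {n} m≤n = /-≤-/ {ℤ.+ m} {1} {ℤ.+ n} {1} (ℤ.*-monoʳ-≤-nonNeg (ℤ.+ 1) (ℤ.+≤+ m≤n))

  nat-cancel-≤ : ∀ {m n} → nat m ℚ.≤ nat n → m ≤ n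
  nat-cancel-≤ {m} {n} h = ℤ.drop‿+≤+ (ℤ.*-cancelʳ-≤-pos (ℤ.+ m) (ℤ.+ n) (ℤ.+ 1) (/-≤-/⁻¹ {ℤ.+ m} {1} {ℤ.+ n} {1} h))

  nat-* : ∀ m n → nat (m * n) ≡ nat m ℚ.* nat n
  nat-* m n = trans (cong (ℚ._/ 1) (ℤ.pos-* m n)) (sym (/-*-/ (ℤ.+ m) 1 (ℤ.+ n) 1))

  1/k*k≡1 : ∀ k .{{_ : NonZero k}} → (ℤ.+ 1 ℚ./ k) ℚ.* nat k ≡ ℚ.1ℚ
  1/k*k≡1 k {{k≢0}} = trans (/-*-/ (ℤ.+ 1) k (ℤ.+ k) 1 {{k≢0}} {{_}} {{m*n≢0 k 1}})
    -- Cross-multiplication through `/-≤-/` yields order only, so the equality is assembled from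
    -- both directions.
    (ℚ.≤-antisym (/-≤-/ {ℤ.+ 1 ℤ.* ℤ.+ k} {k * 1} {ℤ.+ 1} {1} {{m*n≢0 k 1}} (ℤ.≤-reflexive eq))
                 (/-≤-/ {ℤ.+ 1} {1} {ℤ.+ 1 ℤ.* ℤ.+ k} {k * 1} {{_}} {{m*n≢0 k 1}} (ℤ.≤-reflexive (sym eq))))
    where
    eq : ℤ.+ 1 ℤ.* ℤ.+ k ℤ.* ℤ.+ 1 ≡ ℤ.+ 1 ℤ.* ℤ.+ (k * 1)
    eq = trans (ℤ.*-assoc (ℤ.+ 1) (ℤ.+ k) (ℤ.+ 1)) (cong (ℤ.+ 1 ℤ.*_) (sym (ℤ.pos-* k 1)))

module Counting where

  open Rationals using (nat-mono-≤; nat-cancel-≤; nat-*; 1/k*k≡1)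
  open import Defs using (nat; occurrences; rangeLength; HasMajority; DecisionEncoding)

  import Algebra.Properties.CommutativeSemigroup as CommutativeSemigroup
  open import Data.Bool.Base using (Bool; true; false)
  open import Data.Fin.Base as Fin using (Fin; zero; suc; toℕ; fromℕ<)
  import Data.Fin.Properties as Fin
  import Data.Integer.Base as ℤ
  open import Data.List.Base as List
    using (List; []; _∷_; [_]; _++_; length; filter; replicate; applyUpTo; allFin; take; drop; tabulate;
           cartesianProductWith)
  open import Data.List.Extrema.Nat using (argmax; f[xs]≤f[argmax])
  open import Data.List.Properties
    using (filter-++; filter-none; filter-accept; filter-reject; filter-≐; length-++; length-map;
           length-replicate; length-applyUpTo; length-tabulate; map-tabulate; map-++; ++-assoc; ∷-injective)
  open import Data.List.Membership.Propositional using (_∈_)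
  open import Data.List.Membership.Propositional.Properties using (∈-lookup; ∈-cartesianProductWith⁻)
  open import Data.List.Relation.Unary.All as All using (All; []; _∷_)
  import Data.List.Relation.Unary.All.Properties as All
  open import Data.List.Relation.Unary.AllPairs using ([]; _∷_)
  open import Data.List.Relation.Unary.Unique.Propositional using (Unique)
  import Data.List.Relation.Unary.Unique.Propositional.Properties as Unique
  open import Data.Nat.Base
  open import Data.Nat.Divisibility using (∣-refl)
  open import Data.Nat.DivMod
  open import Data.Nat.Properties
  open import Data.Product.Base using (∃-syntax; _×_; _,_; proj₁; proj₂)
  import Data.Rational.Base as ℚ
  import Data.Rational.Properties as ℚ
  open import Data.Sum.Base using (_⊎_; inj₁; inj₂)
  open import Data.Vec.Base as Vec using (Vec; []; _∷_; insertAt; lookup; toList)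
  import Data.Vec.Properties as Vec
  open import Function.Base using (_∘_; id; case_of_)
  open import Function.Bundles using (Equivalence)
  open import Relation.Binary.PropositionalEquality hiding ([_])
  open import Relation.Nullary using (¬_; Dec; yes; no; contradiction)
  open import Relation.Nullary.Decidable using (_×-dec_)
  open import Relation.Unary using (Decidable)

  private variable
    A : Set

  -- Occurrence counts in lists

  occ : ℕ → List ℕ → ℕ
  occ a xs = length (filter (_≟ a) xs)

  occ-++ : ∀ a xs ys → occ a (xs ++ ys) ≡ occ a xs + occ a ys
  occ-++ a xs ys = trans (cong length (filter-++ (_≟ a) xs ys)) (length-++ (filter (_≟ a) xs))

  occ-≡ : ∀ a xs → occ a (a ∷ xs) ≡ suc (occ a xs)
  occ-≡ a xs = cong length (filter-accept (_≟ a) refl)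

  occ-≢ : ∀ {a x} xs → x ≢ a → occ a (x ∷ xs) ≡ occ a xs
  occ-≢ {a} xs x≢a = cong length (filter-reject (_≟ a) x≢a)

  occ-none : ∀ {a xs} → All (_≢ a) xs → occ a xs ≡ 0
  occ-none {a} ≢s = cong length (filter-none (_≟ a) ≢s)

  occ-unique : ∀ a {xs} → Unique xs → occ a xs ≤ 1
  occ-unique a [] = z≤n
  occ-unique a {x ∷ xs} (x∉ ∷ uq) with x ≟ a
  ... | yes refl = ≤-reflexive (trans (occ-≡ a xs) (cong suc (occ-none (All.map ≢-sym x∉))))
  ... | no  x≢a  = ≤-trans (≤-reflexive (occ-≢ xs x≢a)) (occ-unique a uq)

  occ-replicate : ∀ a n → occ a (replicate n a) ≡ n
  occ-replicate a zero    = refl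
  occ-replicate a (suc n) = trans (occ-≡ a (replicate n a)) (cong suc (occ-replicate a n))

  values : ∀ {k n} → Vec (Fin k) n → List ℕ
  values w = List.map toℕ (toList w)

  length-values : ∀ {k n} (w : Vec (Fin k) n) → length (values w) ≡ n
  length-values w = trans (length-map toℕ (toList w)) (Vec.length-toList w)

  values-++ : ∀ {k m n} (v : Vec (Fin k) m) (w : Vec (Fin k) n) → values (v Vec.++ w) ≡ values v ++ values w
  values-++ v w = trans (cong (List.map toℕ) (Vec.toList-++ v w)) (map-++ toℕ (toList v) (toList w))

  -- Enumerating permutations and their concatenations

  insertZero : ∀ {n} → Fin (suc n) → Vec (Fin n) n → Vec (Fin (suc n)) (suc n)
  insertZero i p = insertAt (Vec.map suc p) i zero

  map-suc-injective : ∀ {m n} (p q : Vec (Fin n) m) → Vec.map Fin.suc p ≡ Vec.map suc q → p ≡ q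
  map-suc-injective []      []      _  = refl
  map-suc-injective (x ∷ p) (y ∷ q) eq =
    cong₂ _∷_ (Fin.suc-injective (Vec.∷-injectiveˡ eq)) (map-suc-injective p q (Vec.∷-injectiveʳ eq))

  -- All other entries are successors, so the place of the only zero can be read off. Removing it
  -- leaves the shifted permutation, and shifting is injective.
  insertZero-injective : ∀ {n} {i j : Fin (suc n)} {p q} → insertZero i p ≡ insertZero j q → i ≡ j × p ≡ q
  insertZero-injective {i = i} {j} {p} {q} = go i j p q
    where
    go : ∀ {m n} i j (p q : Vec (Fin n) m) →
         insertAt (Vec.map Fin.suc p) i zero ≡ insertAt (Vec.map suc q) j zero → i ≡ j × p ≡ q
    go zero    zero    p       q       eq = refl , map-suc-injective p q (Vec.∷-injectiveʳ eq)
    go zero    (suc j) p       (y ∷ q) eq = case Vec.∷-injectiveˡ eq of λ ()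
    go (suc i) zero    (x ∷ p) q       eq = case Vec.∷-injectiveˡ eq of λ ()
    go (suc i) (suc j) (x ∷ p) (y ∷ q) eq with go i j p q (Vec.∷-injectiveʳ eq)
    ... | i≡j , p≡q = cong suc i≡j , cong₂ _∷_ (Fin.suc-injective (Vec.∷-injectiveˡ eq)) p≡q

  -- The recursion is on the place of the symbol 0, which gives `suc n` extensions of each shorter
  -- permutation and hence the factorial.
  permutations : ∀ n → List (Vec (Fin n) n)
  permutations zero    = [ [] ]
  permutations (suc n) = cartesianProductWith insertZero (allFin (suc n)) (permutations n)

  length-cartesianProductWith : ∀ {A B C : Set} (f : A → B → C) xs ys →
    length (cartesianProductWith f xs ys) ≡ length xs * length ys
  length-cartesianProductWith f []       ys = refl
  length-cartesianProductWith f (x ∷ xs) ys = trans (length-++ (List.map (f x) ys))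
    (cong₂ _+_ (length-map (f x) ys) (length-cartesianProductWith f xs ys))

  length-permutations : ∀ n → length (permutations n) ≡ n !
  length-permutations zero    = refl
  length-permutations (suc n) = trans (length-cartesianProductWith insertZero (allFin (suc n)) (permutations n))
    (cong₂ _*_ (length-tabulate {n = suc n} id) (length-permutations n))

  permutations-unique : ∀ n → Unique (permutations n)
  permutations-unique zero    = [] ∷ []
  permutations-unique (suc n) =
    Unique.cartesianProductWith⁺ insertZero insertZero-injective (Unique.allFin⁺ (suc n)) (permutations-unique n)

  words : ∀ k m → List (Vec (Fin k) (m * k))
  words k zero    = [ [] ]
  words k (suc m) = cartesianProductWith Vec._++_ (permutations k) (words k m)

  length-words : ∀ k m → length (words k m) ≡ (k !) ^ m
  length-words k zero    = refl
  length-words k (suc m) = trans (length-cartesianProductWith Vec._++_ (permutations k) (words k m))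
    (cong₂ _*_ (length-permutations k) (length-words k m))

  words-unique : ∀ k m → Unique (words k m)
  words-unique k zero    = [] ∷ []
  words-unique k (suc m) = Unique.cartesianProductWith⁺ Vec._++_ (λ {u} {v} → Vec.++-injective u v)
    (permutations-unique k) (words-unique k m)

  -- Symbol counts in permutations

  occ-insertAt : ∀ {k n} a (p : Vec (Fin k) n) i x → occ a (values (insertAt p i x)) ≡ occ a (toℕ x ∷ values p)
  occ-insertAt a p       zero    x = refl
  occ-insertAt a (y ∷ p) (suc i) x = begin
    occ a (toℕ y ∷ values (insertAt p i x))                  ≡⟨ occ-++ a [ toℕ y ] (values (insertAt p i x)) ⟩
    occ a [ toℕ y ] + occ a (values (insertAt p i x))
      ≡⟨ cong (occ a [ toℕ y ] +_) (occ-insertAt a p i x) ⟩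
    occ a [ toℕ y ] + occ a (toℕ x ∷ values p)
      ≡⟨ cong (occ a [ toℕ y ] +_) (occ-++ a [ toℕ x ] (values p)) ⟩
    occ a [ toℕ y ] + (occ a [ toℕ x ] + occ a (values p))
      ≡⟨ x∙yz≈y∙xz (occ a [ toℕ y ]) (occ a [ toℕ x ]) (occ a (values p)) ⟩
    occ a [ toℕ x ] + (occ a [ toℕ y ] + occ a (values p))
      ≡⟨ cong (occ a [ toℕ x ] +_) (occ-++ a [ toℕ y ] (values p)) ⟨
    occ a [ toℕ x ] + occ a (toℕ y ∷ values p)               ≡⟨ occ-++ a [ toℕ x ] (toℕ y ∷ values p) ⟨
    occ a (toℕ x ∷ toℕ y ∷ values p)                         ∎
    where
    open ≡-Reasoning
    open CommutativeSemigroup +-commutativeSemigroup using (x∙yz≈y∙xz)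

  occ-map-suc-zero : ∀ {k n} (p : Vec (Fin k) n) → occ 0 (values (Vec.map suc p)) ≡ 0
  occ-map-suc-zero []      = refl
  occ-map-suc-zero (x ∷ p) = occ-map-suc-zero p

  occ-map-suc : ∀ {k n} a (p : Vec (Fin k) n) → occ (suc a) (values (Vec.map suc p)) ≡ occ a (values p)
  occ-map-suc a []      = refl
  occ-map-suc a (x ∷ p) with toℕ x ≟ a
  ... | yes refl = trans (occ-≡ (suc a) _) (trans (cong suc (occ-map-suc a p)) (sym (occ-≡ a _)))
  ... | no x≢a   = trans (occ-≢ _ (x≢a ∘ suc-injective)) (trans (occ-map-suc a p) (sym (occ-≢ _ x≢a)))

  -- The symbol 0 comes from the insertion alone, since the shift removes it from the rest; any
  -- other symbol `suc a` counts what `a` counted before the shift.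
  permutation-occ : ∀ n {p} → p ∈ permutations n → ∀ {a} → a < n → occ a (values p) ≡ 1
  permutation-occ (suc n) p∈ {a} a<n
    with ∈-cartesianProductWith⁻ insertZero (allFin (suc n)) (permutations n) p∈
  ... | i , q , _ , q∈ , refl = trans (occ-insertAt a (Vec.map suc q) i zero) (go a a<n)
    where
    go : ∀ a → a < suc n → occ a (0 ∷ values (Vec.map suc q)) ≡ 1
    go zero    _         = cong suc (occ-map-suc-zero q)
    go (suc a) (s≤s a<n) = trans (occ-map-suc a q) (permutation-occ n q∈ a<n)

  occ-values-≥ : ∀ {k n} (p : Vec (Fin k) n) {a} → k ≤ a → occ a (values p) ≡ 0
  occ-values-≥ []      k≤a = refl
  occ-values-≥ (x ∷ p) k≤a = trans (occ-≢ _ (<⇒≢ (<-≤-trans (Fin.toℕ<n x) k≤a))) (occ-values-≥ p k≤a)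

  permutation-occ-≤1 : ∀ n {p} → p ∈ permutations n → ∀ a → occ a (values p) ≤ 1
  permutation-occ-≤1 n {p} p∈ a with a <? n
  ... | yes a<n = ≤-reflexive (permutation-occ n p∈ a<n)
  ... | no  a≮n = subst (_≤ 1) (sym (occ-values-≥ p (≮⇒≥ a≮n))) z≤n

  -- Tells whether the entry `x` after the prefix `u` lies in the leading permutation or beyond it;
  -- in the second case the recursion on words continues with `u′`.
  ++-split : ∀ (p w u : List A) {x v} → p ++ w ≡ u ++ x ∷ v →
             (∃[ v′ ] p ≡ u ++ x ∷ v′) ⊎ (∃[ u′ ] u ≡ p ++ u′ × w ≡ u′ ++ x ∷ v)
  ++-split []      w u       eq   = inj₂ (u , refl , eq)
  ++-split (y ∷ p) w []      refl = inj₁ (p , refl)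
  ++-split (y ∷ p) w (z ∷ u) eq with ∷-injective eq
  ... | refl , eq′ with ++-split p w u eq′
  ...   | inj₁ (v′ , refl)        = inj₁ (v′ , refl)
  ...   | inj₂ (u′ , refl , refl) = inj₂ (u′ , refl , refl)

  -- Balance of the prefixes of a word

  module _ (k : ℕ) .{{_ : NonZero k}} where

    -- length u / k is the number of complete permutations in u.
    record CanFollow (u : List ℕ) (x : ℕ) : Set where
      field
        symbol  : x < k
        fresh   : occ x u ≡ length u / k
        bounded : ∀ a → occ a u ≤ suc (length u / k)
        alien   : ∀ {a} → k ≤ a → occ a u ≡ 0

    -- Induction on the number of permutations. An `x` inside the first one has fewer than `k`
    -- predecessors, so the quotient is 0 and no symbol has repeated. Past it, that permutation adds
    -- one to the count of each symbol below `k` and one to the quotient.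
    words-balanced : ∀ m {w} → w ∈ words k m → ∀ u {x v} → values w ≡ u ++ x ∷ v → CanFollow u x
    words-balanced zero    {[]} w∈ []      ()
    words-balanced zero    {[]} w∈ (_ ∷ _) ()
    words-balanced (suc m) w∈ u {x} {v} eq with ∈-cartesianProductWith⁻ Vec._++_ (permutations k) (words k m) w∈
    ... | p , w , p∈ , w∈′ , refl with ++-split (values p) (values w) u (trans (sym (values-++ p w)) eq)
    ...   | inj₁ (v′ , p≡) = record
      { symbol  = x<k
      -- `x` stands right after `u` in the permutation, so an earlier copy would be a second one.
      ; fresh   = trans (n≤0⇒n≡0 (s≤s⁻¹ (begin
          suc (occ x u)                    ≤⟨ m≤m+n (suc (occ x u)) (occ x v′) ⟩
          suc (occ x u + occ x v′)         ≡⟨ +-suc (occ x u) (occ x v′) ⟨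
          occ x u + suc (occ x v′)         ≡⟨ cong (occ x u +_) (occ-≡ x v′) ⟨
          occ x u + occ x (x ∷ v′)         ≡⟨ occ-p x ⟨
          occ x (values p)                 ≤⟨ permutation-occ-≤1 k p∈ x ⟩
          1                                ∎))) (sym u/k≡0)
      ; bounded = λ a → begin
          occ a u                          ≤⟨ u≤p a ⟩
          occ a (values p)                 ≤⟨ permutation-occ-≤1 k p∈ a ⟩
          1                                ≤⟨ s≤s z≤n ⟩
          suc (length u / k)               ∎
      ; alien   = λ {a} k≤a → n≤0⇒n≡0 (subst (occ a u ≤_) (occ-values-≥ p k≤a) (u≤p a))
      }
      where
      open ≤-Reasoning
      occ-p : ∀ a → occ a (values p) ≡ occ a u + occ a (x ∷ v′)
      occ-p a = trans (cong (occ a) p≡) (occ-++ a u (x ∷ v′))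
      u≤p : ∀ a → occ a u ≤ occ a (values p)
      u≤p a = ≤-trans (m≤m+n (occ a u) _) (≤-reflexive (sym (occ-p a)))
      u/k≡0 : length u / k ≡ 0
      u/k≡0 = m<n⇒m/n≡0 (begin-strict
        length u                           <⟨ m<m+n (length u) z<s ⟩
        length u + length (x ∷ v′)         ≡⟨ length-++ u ⟨
        length (u ++ x ∷ v′)               ≡⟨ cong length p≡ ⟨
        length (values p)                  ≡⟨ length-values p ⟩
        k                                  ∎)
      x<k : x < k
      -- A value from `k` on never occurs in `p`, but `x` does.
      x<k = ≰⇒> λ k≤x → 1+n≢0 (sym (trans (sym (occ-values-≥ p k≤x))
        (trans (occ-p x) (trans (cong (occ x u +_) (occ-≡ x v′)) (+-suc _ _)))))
    ...   | inj₂ (u′ , refl , w≡) = record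
      { symbol  = ih.symbol
      ; fresh   = trans (occ-++ x (values p) u′)
          (trans (cong₂ _+_ (permutation-occ k p∈ ih.symbol) ih.fresh) (sym u/k))
      ; bounded = λ a → begin
          occ a (values p ++ u′)                ≡⟨ occ-++ a (values p) u′ ⟩
          occ a (values p) + occ a u′           ≤⟨ +-mono-≤ (permutation-occ-≤1 k p∈ a) (ih.bounded a) ⟩
          1 + suc (length u′ / k)               ≡⟨ cong suc u/k ⟨
          suc (length (values p ++ u′) / k)     ∎
      ; alien   = λ {a} k≤a → trans (occ-++ a (values p) u′) (cong₂ _+_ (occ-values-≥ p k≤a) (ih.alien k≤a))
      }
      where
      open ≤-Reasoning
      module ih = CanFollow (words-balanced m w∈′ u′ w≡)
      u/k : length (values p ++ u′) / k ≡ suc (length u′ / k)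
      u/k = trans (cong (_/ k) (trans (length-++ (values p)) (cong (_+ length u′) (length-values p))))
        (trans (+-distrib-/-∣ˡ (length u′) ∣-refl) (cong (_+ length u′ / k) (n/n≡1 k)))

  -- The gadget and its suffixes

  -- Reading from the right, block x lifts the count of x from 0 to x+1, above the other symbols; the
  -- entries from k on are fillers, at most one of each kind per block.
  block : ℕ → ℕ → List ℕ
  block k x = replicate (suc x) x ++ applyUpTo (k +_) (k ∸ suc x)

  gadget : ℕ → ℕ → List ℕ
  gadget k zero    = []
  gadget k (suc x) = block k x ++ gadget k x

  length-block : ∀ {k x} → x < k → length (block k x) ≡ k
  length-block {k} {x} x<k = trans (length-++ (replicate (suc x) x))
    (trans (cong₂ _+_ (length-replicate (suc x)) (length-applyUpTo (k +_) (k ∸ suc x))) (m+[n∸m]≡n x<k))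

  length-gadget : ∀ {k} x → x ≤ k → length (gadget k x) ≡ x * k
  length-gadget     zero    _   = refl
  length-gadget {k} (suc x) x<k = trans (length-++ (block k x))
    (cong₂ _+_ (length-block x<k) (length-gadget x (<⇒≤ x<k)))

  occ-fillers-< : ∀ {a k} m → a < k → occ a (applyUpTo (k +_) m) ≡ 0
  occ-fillers-< {k = k} m a<k = occ-none (All.applyUpTo⁺₂ (k +_) m λ i → >⇒≢ (<-≤-trans a<k (m≤m+n k i)))

  occ-fillers-≤1 : ∀ a k m → occ a (applyUpTo (k +_) m) ≤ 1
  occ-fillers-≤1 a k m = occ-unique a (Unique.applyUpTo⁺₁ (k +_) m λ i<j _ → <⇒≢ (+-monoʳ-< k i<j))

  occ-block-≢ : ∀ {a x} k → x ≢ a → occ a (block k x) ≡ occ a (applyUpTo (k +_) (k ∸ suc x))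
  occ-block-≢ {a} {x} k x≢a = trans (occ-++ a (replicate (suc x) x) _)
    (cong (_+ occ a (applyUpTo (k +_) (k ∸ suc x))) (occ-none (All.replicate⁺ (suc x) x≢a)))

  occ-block : ∀ {k x} → x < k → occ x (block k x) ≡ suc x
  occ-block {k} {x} x<k = trans (occ-++ x (replicate (suc x) x) _)
    (trans (cong₂ _+_ (occ-replicate x (suc x)) (occ-fillers-< (k ∸ suc x) x<k)) (+-identityʳ (suc x)))

  -- The symbol `a` first appears in block `a`, which a gadget of at most `a` blocks lacks.
  occ-gadget-≥ : ∀ {k a} x → x ≤ a → a < k → occ a (gadget k x) ≡ 0
  occ-gadget-≥         zero    _   _   = refl
  occ-gadget-≥ {k} {a} (suc x) x<a a<k = trans (occ-++ a (block k x) (gadget k x))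
    (cong₂ _+_ (trans (occ-block-≢ k (<⇒≢ x<a)) (occ-fillers-< (k ∸ suc x) a<k)) (occ-gadget-≥ x (<⇒≤ x<a) a<k))

  occ-gadget : ∀ {k x} → x < k → occ x (gadget k (suc x)) ≡ suc x
  occ-gadget {k} {x} x<k = trans (occ-++ x (block k x) (gadget k x))
    (trans (cong₂ _+_ (occ-block x<k) (occ-gadget-≥ x ≤-refl x<k)) (+-identityʳ (suc x)))

  mutual

    -- When block `x` is added, the symbol `x` jumps from 0 to `suc x`, every other symbol below `k`
    -- gains nothing, and a filler gains at most one. So no count passes the number of blocks.
    occ-gadget-≤ : ∀ {k} a x → x ≤ k → occ a (gadget k x) ≤ x
    occ-gadget-≤     a zero    _   = z≤n
    occ-gadget-≤ {k} a (suc x) x<k with a <? k | x ≟ a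
    ... | yes _   | yes refl = ≤-reflexive (occ-gadget x<k)
    ... | yes a<k | no x≢a   = m≤n⇒m≤1+n (occ-gadget-≢ x<k a<k x≢a)
    ... | no a≮k  | _        = begin
      occ a (block k x ++ gadget k x)            ≡⟨ occ-++ a (block k x) (gadget k x) ⟩
      occ a (block k x) + occ a (gadget k x)
        ≤⟨ +-mono-≤ (≤-trans (≤-reflexive (occ-block-≢ k (<⇒≢ (<-≤-trans x<k (≮⇒≥ a≮k))))) (occ-fillers-≤1 a k (k ∸ suc x)))
                    (occ-gadget-≤ a x (<⇒≤ x<k)) ⟩
      suc x                                      ∎
      where open ≤-Reasoning

    occ-gadget-≢ : ∀ {k a x} → x < k → a < k → x ≢ a → occ a (gadget k (suc x)) ≤ x
    occ-gadget-≢ {k} {a} {x} x<k a<k x≢a = begin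
      occ a (block k x ++ gadget k x)            ≡⟨ occ-++ a (block k x) (gadget k x) ⟩
      occ a (block k x) + occ a (gadget k x)
        ≡⟨ cong (_+ occ a (gadget k x)) (trans (occ-block-≢ k x≢a) (occ-fillers-< (k ∸ suc x) a<k)) ⟩
      occ a (gadget k x)                         ≤⟨ occ-gadget-≤ a x (<⇒≤ x<k) ⟩
      x                                          ∎
      where open ≤-Reasoning

  -- Larger gadgets prepend blocks, so a window inside `gadget k k` can start at any level.
  gadget-suffix : ∀ k {x y} → x ≤ y → ∃[ pre ] gadget k y ≡ pre ++ gadget k x
  gadget-suffix k {x} {y} x≤y = go (≤⇒≤′ x≤y)
    where
    go : ∀ {y} → x ≤′ y → ∃[ pre ] gadget k y ≡ pre ++ gadget k x
    go ≤′-refl = [] , refl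
    go (≤′-step {y} x≤y) = let (pre , eq) = go x≤y in
      block k y ++ pre , trans (cong (block k y ++_) eq) (sym (++-assoc (block k y) pre (gadget k x)))

  -- Windows that test the next symbol

  module Window {k} .{{_ : NonZero k}} {u x} (x-next : CanFollow k u x) where
    open CanFollow x-next
    open ≤-Reasoning

    window : ℕ → List ℕ
    window y = gadget k (suc x) ++ u ++ [ y ]

    length-window : ∀ y → length (window y) ≡ suc (suc x * k + length u)
    length-window y = trans (length-++ (gadget k (suc x))) (trans (cong₂ _+_ (length-gadget (suc x) symbol)
      (trans (length-++ u) (+-comm (length u) 1))) (+-suc (suc x * k) (length u)))

    occ-window : ∀ a y → occ a (window y) ≡ occ a (gadget k (suc x)) + (occ a u + occ a [ y ])
    occ-window a y = trans (occ-++ a (gadget k (suc x)) (u ++ [ y ]))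
      (cong (occ a (gadget k (suc x)) +_) (occ-++ a u [ y ]))

    b : ℕ
    b = length u / k

    -- `x` occurs `suc x` times in the gadget, `b` times in `u` and once at the end, while the part
    -- after the gadget has at most `suc b * k` entries.
    window-yes : length (window x) ≤ k * occ x (window x)
    window-yes = begin
      length (window x)                  ≡⟨ length-window x ⟩
      suc (suc x * k + length u)         ≡⟨ +-suc (suc x * k) (length u) ⟨
      suc x * k + suc (length u)         ≤⟨ +-monoʳ-≤ (suc x * k) (m<[1+n/k]*k (length u)) ⟩
      suc x * k + suc b * k              ≡⟨ *-distribʳ-+ k (suc x) (suc b) ⟨
      (suc x + suc b) * k                ≡⟨ *-comm (suc x + suc b) k ⟩
      k * (suc x + suc b)                ≡⟨ cong (k *_) (sym occ-x) ⟩
      k * occ x (window x)               ∎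
      where
      m<[1+n/k]*k : ∀ n → n < suc (n / k) * k
      m<[1+n/k]*k n = begin-strict
        n                    ≡⟨ m≡m%n+[m/n]*n n k ⟩
        n % k + n / k * k    <⟨ +-monoˡ-< (n / k * k) (m%n<n n k) ⟩
        suc (n / k) * k      ∎
      occ-x : occ x (window x) ≡ suc x + suc b
      occ-x = trans (occ-window x x) (cong₂ _+_ (occ-gadget symbol)
        (trans (cong₂ _+_ fresh (occ-≡ x [])) (+-comm b 1)))

    -- Every count is at most `suc x + b`: `x` misses its last occurrence, and any other symbol
    -- below `k`, with up to `suc b` occurrences after the gadget, has at most `x` inside it. The
    -- final entry makes the length exceed `(suc x + b) * k`.
    window-no : ∀ {y} → CanFollow k u y → x ≢ y → ∀ a → k * occ a (window y) < length (window y)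
    window-no {y} y-next x≢y a = begin-strict
      k * occ a (window y)
        ≤⟨ *-monoʳ-≤ k (≤-trans (≤-reflexive (occ-window a y)) (occ-≤ (a ≟ x) (a ≟ y) (a <? k))) ⟩
      k * (suc x + b)                    ≡⟨ *-comm k (suc x + b) ⟩
      (suc x + b) * k                    ≡⟨ *-distribʳ-+ k (suc x) b ⟩
      suc x * k + b * k                  ≤⟨ +-monoʳ-≤ (suc x * k) (m/n*n≤m (length u) k) ⟩
      suc x * k + length u               <⟨ n<1+n _ ⟩
      suc (suc x * k + length u)         ≡⟨ length-window y ⟨
      length (window y)                  ∎
      where
      module y = CanFollow y-next
      shift : x + suc b ≤ suc x + b
      shift = ≤-reflexive (+-suc x b)
      occ-≤ : Dec (a ≡ x) → Dec (a ≡ y) → Dec (a < k) →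
              occ a (gadget k (suc x)) + (occ a u + occ a [ y ]) ≤ suc x + b
      occ-≤ (yes refl) _ _ = +-mono-≤ (≤-reflexive (occ-gadget symbol))
        (≤-reflexive (trans (cong₂ _+_ fresh (occ-≢ [] (x≢y ∘ sym))) (+-identityʳ b)))
      occ-≤ (no a≢x) (yes refl) _ = ≤-trans
        (+-mono-≤ (occ-gadget-≢ symbol y.symbol x≢y)
          (≤-reflexive (trans (cong₂ _+_ y.fresh (occ-≡ y [])) (+-comm b 1)))) shift
      occ-≤ (no a≢x) (no a≢y) (yes a<k) = ≤-trans
        (+-mono-≤ (occ-gadget-≢ symbol a<k (a≢x ∘ sym))
          (≤-trans (≤-reflexive (trans (cong (occ a u +_) (occ-≢ [] (a≢y ∘ sym))) (+-identityʳ _))) (bounded a))) shift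
      -- A filler may reach `suc x` in the gadget but never occurs after it.
      occ-≤ (no a≢x) (no a≢y) (no a≮k) = +-mono-≤ (occ-gadget-≤ a (suc x) symbol)
        (≤-trans (≤-reflexive (cong₂ _+_ (alien (≮⇒≥ a≮k)) (occ-≢ [] (a≢y ∘ sym)))) z≤n)

  -- The prefix `u` is common to both words, so a single query range, ending at the entry after `u`,
  -- can be read in both arrays with the same `b`.
  first-difference : ∀ {k n} (v w : Vec (Fin k) n) → v ≡ w ⊎
    (∃[ u ] ∃[ x ] ∃[ y ] ∃[ v′ ] ∃[ w′ ] x ≢ y × values v ≡ u ++ x ∷ v′ × values w ≡ u ++ y ∷ w′)
  first-difference []      []      = inj₁ refl
  first-difference (x ∷ v) (y ∷ w) with x Fin.≟ y
  ... | no x≢y = inj₂ ([] , toℕ x , toℕ y , values v , values w , x≢y ∘ Fin.toℕ-injective , refl , refl)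
  ... | yes refl with first-difference v w
  ...   | inj₁ refl = inj₁ refl
  ...   | inj₂ (u , x′ , y′ , v′ , w′ , x≢y , eq , eq′) =
    inj₂ (toℕ x ∷ u , x′ , y′ , v′ , w′ , x≢y , cong (toℕ x ∷_) eq , cong (toℕ x ∷_) eq′)

  -- Counting in arrays and in lists

  padRight : ∀ n → List ℕ → Vec ℕ n
  padRight zero    _        = []
  padRight (suc n) []       = 0 ∷ padRight n []
  padRight (suc n) (x ∷ xs) = x ∷ padRight n xs

  length-filter-map : ∀ {A B : Set} {P : B → Set} (P? : Decidable P) (f : A → B) xs →
                      length (filter P? (List.map f xs)) ≡ length (filter (P? ∘ f) xs)
  length-filter-map P? f [] = refl
  length-filter-map P? f (x ∷ xs) with P? (f x)
  ... | yes _ = cong suc (length-filter-map P? f xs)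
  ... | no  _ = length-filter-map P? f xs

  -- Half-open bounds, unlike the closed ones of `occurrences`: `hi` may be 0, and removing the head
  -- lowers `hi` by one and a positive `lo` as well.
  InWindow : ∀ {n} → ℕ → ℕ → ℕ → Vec ℕ n → Fin n → Set
  InWindow a lo hi A t = lo ≤ toℕ t × toℕ t < hi × lookup A t ≡ a

  inWindow? : ∀ {n} a lo hi (A : Vec ℕ n) → Decidable (InWindow a lo hi A)
  inWindow? a lo hi A t = (lo ≤? toℕ t) ×-dec (toℕ t <? hi) ×-dec (lookup A t ≟ a)

  windowCount : ∀ {n} → ℕ → ℕ → ℕ → Vec ℕ n → ℕ
  windowCount {n} a lo hi A = length (filter (inWindow? a lo hi A) (allFin n))

  windowCount-∷ : ∀ {n} a lo hi x (A : Vec ℕ n) →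
                  length (filter (inWindow? a lo (suc hi) (x ∷ A)) (tabulate suc)) ≡ windowCount a (pred lo) hi A
  windowCount-∷ {n} a lo hi x A = begin
    length (filter P? (tabulate suc))                    ≡⟨ cong (length ∘ filter P?) (map-tabulate id suc) ⟨
    length (filter P? (List.map suc (allFin n)))         ≡⟨ length-filter-map P? suc (allFin n) ⟩
    length (filter (P? ∘ suc) (allFin n))                ≡⟨ cong length (filter-≐ (P? ∘ suc) (inWindow? a (pred lo) hi A)
                                                              ((λ (p , q , r) → pred-mono-≤ p , s≤s⁻¹ q , r) ,
                                                               (λ (p , q , r) → lo≤ lo p , s≤s q , r)) (allFin n)) ⟩
    windowCount a (pred lo) hi A                         ∎
    where
    open ≡-Reasoning
    P? = inWindow? a lo (suc hi) (x ∷ A)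
    lo≤ : ∀ lo {t} → pred lo ≤ t → lo ≤ suc t
    lo≤ zero     _ = z≤n
    lo≤ (suc lo) p = s≤s p

  windowCount-zero : ∀ {n} a lo (A : Vec ℕ n) → windowCount a lo 0 A ≡ 0
  windowCount-zero {n} a lo A = cong length (filter-none (inWindow? a lo 0 A) {xs = allFin n} (All.tabulate λ _ ()))

  drop-[] : ∀ {A : Set} m → drop {A = A} m [] ≡ []
  drop-[] zero    = refl
  drop-[] (suc m) = refl

  -- Turns a count over positions into a count over a sublist. The head is skipped while `lo` is
  -- positive and tested against `a` once `lo` is 0.
  windowCount-padRight : ∀ {n} a lo {hi} xs → hi ≤ n → hi ≤ length xs →
                         windowCount a lo hi (padRight n xs) ≡ occ a (drop lo (take hi xs))
  windowCount-padRight {n} a lo {zero} xs _ _ =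
    trans (windowCount-zero a lo (padRight n xs)) (cong (occ a) (sym (drop-[] lo)))
  windowCount-padRight {suc n} a (suc lo) {suc hi} (x ∷ xs) (s≤s hi≤n) (s≤s hi≤l) = begin
    windowCount a (suc lo) (suc hi) (x ∷ padRight n xs)
      ≡⟨ cong length (filter-reject (inWindow? a (suc lo) (suc hi) (x ∷ padRight n xs)) {zero} {tabulate suc} λ ()) ⟩
    length (filter (inWindow? a (suc lo) (suc hi) (x ∷ padRight n xs)) (tabulate suc))
      ≡⟨ windowCount-∷ a (suc lo) hi x (padRight n xs) ⟩
    windowCount a lo hi (padRight n xs)
      ≡⟨ windowCount-padRight a lo xs hi≤n hi≤l ⟩
    occ a (drop lo (take hi xs)) ∎
    where open ≡-Reasoning
  windowCount-padRight {suc n} a zero {suc hi} (x ∷ xs) (s≤s hi≤n) (s≤s hi≤l) = go (x ≟ a)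
    where
    in? = inWindow? a 0 (suc hi) (x ∷ padRight n xs)
    rest : length (filter in? (tabulate suc)) ≡ occ a (take hi xs)
    rest = trans (windowCount-∷ a 0 hi x (padRight n xs)) (windowCount-padRight a 0 xs hi≤n hi≤l)
    go : Dec (x ≡ a) → windowCount a 0 (suc hi) (x ∷ padRight n xs) ≡ occ a (x ∷ take hi xs)
    go (yes refl) = trans (cong length (filter-accept in? {zero} {tabulate suc} (z≤n , z<s , refl)))
      (trans (cong suc rest) (sym (occ-≡ a (take hi xs))))
    go (no x≢a) = trans (cong length (filter-reject in? {zero} {tabulate suc} λ (_ , _ , eq) → x≢a eq))
      (trans rest (sym (occ-≢ (take hi xs) x≢a)))

  occurrences-padRight : ∀ {n} xs (i j : Fin n) a → suc (toℕ j) ≤ length xs →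
                         occurrences (padRight n xs) i j a ≡ occ a (drop (toℕ i) (take (suc (toℕ j)) xs))
  occurrences-padRight {n} xs i j a j<l = trans
    (cong length (filter-≐ _ (inWindow? a (toℕ i) (suc (toℕ j)) (padRight n xs))
      ((λ (p , q , r) → p , s≤s q , r) , (λ (p , q , r) → p , s≤s⁻¹ q , r)) (allFin n)))
    (windowCount-padRight a (toℕ i) xs (Fin.toℕ<n j) j<l)

  drop-take-++ : ∀ {A : Set} (pre win post : List A) →
                 drop (length pre) (take (length pre + length win) (pre ++ win ++ post)) ≡ win
  drop-take-++ []        win post = go win
    where
    go : ∀ win → take (length win) (win ++ post) ≡ win
    go []        = refl
    go (x ∷ win) = cong (x ∷_) (go win)
  drop-take-++ (x ∷ pre) win post = drop-take-++ pre win post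

  -- Distinct words have distinct codes

  module _ (k : ℕ) .{{k≢0 : NonZero k}} where

    private
      -- Writing `nat c` as a multiple of 1/k turns the majority condition into `l ≤ k * c` over the
      -- naturals, in both directions.
      scale-1/k : ∀ c → (ℤ.+ 1 ℚ./ k) ℚ.* nat (k * c) ≡ nat c
      scale-1/k c = trans (cong ((ℤ.+ 1 ℚ./ k) ℚ.*_) (nat-* k c))
        (trans (sym (ℚ.*-assoc (ℤ.+ 1 ℚ./ k) (nat k) (nat c)))
        (trans (cong (ℚ._* nat c) (1/k*k≡1 k)) (ℚ.*-identityˡ (nat c))))
      0<1/k : ℚ.0ℚ ℚ.< ℤ.+ 1 ℚ./ k
      0<1/k = ℚ.positive⁻¹ _ {{ℚ.normalize-pos 1 k}}

    majority⁺ : ∀ {l c} → l ≤ k * c → (ℤ.+ 1 ℚ./ k) ℚ.* nat l ℚ.≤ nat c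
    majority⁺ {l} {c} h = subst ((ℤ.+ 1 ℚ./ k) ℚ.* nat l ℚ.≤_) (scale-1/k c)
      (ℚ.*-monoˡ-≤-nonNeg (ℤ.+ 1 ℚ./ k) {{ℚ.nonNegative (ℚ.<⇒≤ 0<1/k)}} {nat l} {nat (k * c)} (nat-mono-≤ {l} {k * c} h))

    majority⁻ : ∀ {l c} → (ℤ.+ 1 ℚ./ k) ℚ.* nat l ℚ.≤ nat c → l ≤ k * c
    majority⁻ {l} {c} h = nat-cancel-≤ {l} {k * c}
      (ℚ.*-cancelˡ-≤-pos {nat l} {nat (k * c)} (ℤ.+ 1 ℚ./ k) {{ℚ.positive 0<1/k}}
      (subst ((ℤ.+ 1 ℚ./ k) ℚ.* nat l ℚ.≤_) (sym (scale-1/k c)) h))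

    module _ {n : ℕ} (m : ℕ) (D : DecisionEncoding (ℤ.+ 1 ℚ./ k) n) (fits : k * k + m * k ≤ n) where
      open DecisionEncoding D

      -- Zeros fill the positions after the last permutation; the queried ranges end before them.
      array : Vec (Fin k) (m * k) → Vec ℕ n
      array w = padRight n (gadget k k ++ values w)

      -- At the first difference the window ending there has a majority in one array and none in the
      -- other, while equal codes force the same answer to that query.
      encode-injective : ∀ {v w} → v ∈ words k m → w ∈ words k m → encode (array v) ≡ encode (array w) → v ≡ w
      encode-injective {v} {w} v∈ w∈ same with first-difference v w
      ... | inj₁ v≡w = v≡w
      ... | inj₂ (u , x , y , v′ , w′ , x≢y , v≡ , w≡) = contradiction
          (Equivalence.to (correct (array w) i j i≤j)
            (trans (cong (λ c → query c i j) (sym same)) (Equivalence.from (correct (array v) i j i≤j) yes-v)))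
          no-w
        where
        τ = ℤ.+ 1 ℚ./ k
        x-next = words-balanced k m v∈ u v≡
        y-next = words-balanced k m w∈ u w≡
        -- The range is chosen by `x`, the symbol of `v`; `window y` is the content of the same
        -- range in the other array.
        open Window x-next
        x<k = CanFollow.symbol x-next
        -- What precedes the suffix of `suc x` blocks; its length is the left end `i`.
        pre = proj₁ (gadget-suffix k x<k)
        -- One less than the length of the window, because the right end `j` is included.
        len = suc x * k + length u

        split : ∀ {z t′} t → values t ≡ u ++ z ∷ t′ → gadget k k ++ values t ≡ pre ++ window z ++ t′
        split {z} {t′} t t≡ = begin
          gadget k k ++ values t                            ≡⟨ cong₂ _++_ (proj₂ (gadget-suffix k x<k)) t≡ ⟩
          (pre ++ gadget k (suc x)) ++ u ++ z ∷ t′          ≡⟨ ++-assoc pre (gadget k (suc x)) (u ++ z ∷ t′) ⟩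
          pre ++ gadget k (suc x) ++ u ++ z ∷ t′
            ≡⟨ cong (λ s → pre ++ gadget k (suc x) ++ s) (++-assoc u [ z ] t′) ⟨
          pre ++ gadget k (suc x) ++ (u ++ [ z ]) ++ t′
            ≡⟨ cong (pre ++_) (++-assoc (gadget k (suc x)) (u ++ [ z ]) t′) ⟨
          pre ++ window z ++ t′                             ∎
          where open ≡-Reasoning

        last-< : ∀ {z t′} t → values t ≡ u ++ z ∷ t′ → length pre + len < length (gadget k k ++ values t)
        last-< {z} {t′} t t≡ = begin-strict
          length pre + len                                    <⟨ +-monoʳ-< (length pre) ≤-refl ⟩
          length pre + suc len                                ≡⟨ cong (length pre +_) (length-window z) ⟨
          length pre + length (window z)
            ≤⟨ +-monoʳ-≤ (length pre) (m≤m+n (length (window z)) (length t′)) ⟩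
          length pre + (length (window z) + length t′)        ≡⟨ cong (length pre +_) (length-++ (window z)) ⟨
          length pre + length (window z ++ t′)                ≡⟨ length-++ pre ⟨
          length (pre ++ window z ++ t′)                      ≡⟨ cong length (split t t≡) ⟨
          length (gadget k k ++ values t)                     ∎
          where open ≤-Reasoning

        last<n : length pre + len < n
        last<n = <-≤-trans (last-< v v≡) (≤-trans (≤-reflexive (trans (length-++ (gadget k k))
          (cong₂ _+_ (length-gadget k ≤-refl) (length-values v)))) fits)
        first<n : length pre < n
        first<n = ≤-<-trans (m≤m+n (length pre) len) last<n
        i j : Fin n
        i = fromℕ< first<n
        j = fromℕ< last<n
        toℕ-i : toℕ i ≡ length pre
        toℕ-i = Fin.toℕ-fromℕ< first<n
        toℕ-j : toℕ j ≡ length pre + len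
        toℕ-j = Fin.toℕ-fromℕ< last<n
        i≤j : i Fin.≤ j
        i≤j = subst₂ _≤_ (sym toℕ-i) (sym toℕ-j) (m≤m+n (length pre) len)

        range-length : ∀ z → rangeLength i j ≡ length (window z)
        range-length z = trans (cong₂ (λ p q → suc p ∸ q) toℕ-j toℕ-i)
          (trans (cong (_∸ length pre) (sym (+-suc (length pre) len)))
          (trans (m+n∸m≡n (length pre) (suc len)) (sym (length-window z))))

        occurrences-window : ∀ {z t′} t → values t ≡ u ++ z ∷ t′ → ∀ a → occurrences (array t) i j a ≡ occ a (window z)
        occurrences-window {z} {t′} t t≡ a = trans
          (occurrences-padRight (gadget k k ++ values t) i j a
            (subst (_< length (gadget k k ++ values t)) (sym toℕ-j) (last-< t t≡)))
          (cong (occ a) (begin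
            drop (toℕ i) (take (suc (toℕ j)) (gadget k k ++ values t))
              ≡⟨ cong₂ (λ p q → drop p (take (suc q) (gadget k k ++ values t))) toℕ-i toℕ-j ⟩
            drop (length pre) (take (suc (length pre + len)) (gadget k k ++ values t))
              ≡⟨ cong₂ (λ p q → drop (length pre) (take p q))
                   (trans (sym (+-suc (length pre) len)) (cong (length pre +_) (sym (length-window z)))) (split t t≡) ⟩
            drop (length pre) (take (length pre + length (window z)) (pre ++ window z ++ t′))
              ≡⟨ drop-take-++ pre (window z) t′ ⟩
            window z ∎))
          where open ≡-Reasoning

        yes-v : HasMajority τ (array v) i j
        yes-v = x , subst₂ (λ l c → τ ℚ.* nat l ℚ.≤ nat c) (sym (range-length x)) (sym (occurrences-window v v≡ x))
          (majority⁺ window-yes)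

        no-w : ¬ HasMajority τ (array w) i j
        no-w (a , h) = <⇒≱ (window-no y-next x≢y a) (majority⁻
          (subst₂ (λ l c → τ ℚ.* nat l ℚ.≤ nat c) (range-length y) (occurrences-window w w≡ a) h))

  -- Bit strings and the longest code

  -- Bijective base-two numeration.
  toNat : List Bool → ℕ
  toNat []           = 0
  toNat (false ∷ bs) = 1 + 2 * toNat bs
  toNat (true  ∷ bs) = 2 + 2 * toNat bs

  toNat-injective : ∀ bs cs → toNat bs ≡ toNat cs → bs ≡ cs
  toNat-injective []           []           _  = refl
  toNat-injective []           (false ∷ cs) ()
  toNat-injective []           (true  ∷ cs) ()
  toNat-injective (false ∷ bs) []           ()
  toNat-injective (true  ∷ bs) []           ()
  toNat-injective (false ∷ bs) (false ∷ cs) eq =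
    cong (false ∷_) (toNat-injective bs cs (*-cancelˡ-≡ _ _ 2 (suc-injective eq)))
  toNat-injective (true  ∷ bs) (true  ∷ cs) eq =
    cong (true ∷_) (toNat-injective bs cs (*-cancelˡ-≡ _ _ 2 (suc-injective (suc-injective eq))))
  toNat-injective (false ∷ bs) (true  ∷ cs) eq = contradiction (suc-injective eq) (even≢odd (toNat bs) (toNat cs))
  toNat-injective (true  ∷ bs) (false ∷ cs) eq = contradiction (sym (suc-injective eq)) (even≢odd (toNat cs) (toNat bs))

  -- The outer `suc` carries the induction: a gap of 2 below the power becomes 4 on doubling, and
  -- the added bit takes at most 2 of it.
  toNat-< : ∀ bs → suc (toNat bs) < 2 ^ suc (length bs)
  toNat-< []       = s≤s (s≤s z≤n)
  toNat-< (b ∷ bs) = <-≤-trans (s≤s (s≤s (bound b)))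
    (≤-trans (≤-reflexive (sym (*-distribˡ-+ 2 2 (toNat bs)))) (*-monoʳ-≤ 2 (toNat-< bs)))
    where
    bound : ∀ b → toNat (b ∷ bs) ≤ 2 + 2 * toNat bs
    bound false = n≤1+n _
    bound true  = ≤-refl

  lookup-injective : ∀ {A : Set} {xs : List A} → Unique xs → ∀ i j → List.lookup xs i ≡ List.lookup xs j → i ≡ j
  lookup-injective (x∉ ∷ uq) zero    zero    _  = refl
  lookup-injective (x∉ ∷ uq) zero    (suc j) eq = contradiction eq (All.lookup x∉ (∈-lookup j))
  lookup-injective (x∉ ∷ uq) (suc i) zero    eq = contradiction (sym eq) (All.lookup x∉ (∈-lookup i))
  lookup-injective (x∉ ∷ uq) (suc i) (suc j) eq = cong suc (lookup-injective uq i j eq)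

  -- Pigeonhole: the members of `xs` inject, through their codes, into the `2 ^ suc l ∸ 1` bit
  -- strings of length at most `l`.
  unique-codes : ∀ {A : Set} {xs : List A} (f : A → List Bool) l → Unique xs →
                 (∀ {x y} → x ∈ xs → y ∈ xs → f x ≡ f y → x ≡ y) →
                 All (λ x → length (f x) ≤ l) xs → length xs < 2 ^ suc l
  unique-codes {xs = xs} f l uq inj short = ≤-<-trans
    (Fin.injective⇒≤ {f = number} λ {i} {j} eq → lookup-injective uq i j (inj (∈-lookup i) (∈-lookup j)
      (toNat-injective _ _ (Fin.fromℕ<-injective _ _ (number-< i) (number-< j) eq))))
    (pred-< {{m^n≢0 2 (suc l)}})
    where
    number-< : ∀ i → toNat (f (List.lookup xs i)) < pred (2 ^ suc l)
    number-< i = pred-mono-≤ (≤-trans (toNat-< (f (List.lookup xs i)))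
      (^-monoʳ-≤ 2 (s≤s (All.lookup short (∈-lookup i)))))
    number : Fin (length xs) → Fin (pred (2 ^ suc l))
    number i = fromℕ< (number-< i)
    pred-< : ∀ {n} .{{_ : NonZero n}} → pred n < n
    pred-< {suc n} = ≤-refl

  long-code : ∀ k .{{_ : NonZero k}} {n} m (D : DecisionEncoding (ℤ.+ 1 ℚ./ k) n) → k * k + m * k ≤ n →
              ∃[ A ] (k !) ^ m < 2 ^ suc (length (DecisionEncoding.encode D A))
  long-code k {n} m D fits = array k m D fits best , subst (_< 2 ^ suc (size best)) (length-words k m)
    (unique-codes code (size best) (words-unique k m) (encode-injective k m D fits)
      (f[xs]≤f[argmax] {f = size} (Vec.replicate (m * k) someSymbol) (words k m)))
    where
    open DecisionEncoding D
    code = encode ∘ array k m D fits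
    size = length ∘ code
    someSymbol = fromℕ< (>-nonZero⁻¹ k)
    -- `argmax` asks for a default. A constant word serves whether or not it lies in `words`,
    -- because the bound concerns only the length of the code of the array chosen.
    best = argmax size (Vec.replicate (m * k) someSymbol) (words k m)

module Logarithms where

  open Rationals using (nat-*; nat-mono-≤; 1/k*k≡1)
  open import Defs
  open RationalLemmas
  open ExpSumLemmas using (invFact-pos)
  open ℝ using (L; U)
  open ℝ⁺ using (real)

  import Algebra.Properties.CommutativeSemiring.Binomial as Binomial
  import Algebra.Properties.Monoid.Sum as Sum
  import Algebra.Definitions.RawMonoid as RawMonoid
  open import Algebra.Bundles using (CommutativeRing)
  open import Data.Bool.Base using (true; false)
  open import Data.Empty using (⊥-elim)
  open import Data.Fin.Base as Fin using (Fin; zero; suc; toℕ; inject₁)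
  import Data.Fin.Properties as Fin
  open import Data.Integer.Base as ℤ using (+_; -[1+_])
  import Data.Integer.Properties as ℤ
  open import Data.Nat.Base as ℕ using (ℕ; zero; suc; _!)
  import Data.Nat.Properties as ℕ
  open import Data.Nat.Combinatorics using (_C_; _P_; nCk≡nPk/k!)
  open import Data.Nat.Combinatorics.Base using (_P′_)
  import Data.Nat.DivMod as ℕ
  open import Data.Product.Base using (∃-syntax; _×_; _,_; proj₁; proj₂)
  open import Data.Rational.Base
  open import Data.Rational.Properties
  open import Data.Rational.Solver using (module +-*-Solver)
  open import Data.Sum.Base using (inj₁; inj₂)
  open import Function.Base using (_∘_)
  open import Relation.Binary.PropositionalEquality
  open import Relation.Nullary using (yes; no)

  private
    ℚ-semiring = CommutativeRing.commutativeSemiring +-*-commutativeRing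

  open Binomial ℚ-semiring using (binomialTerm) renaming (theorem to binomial-theorem)
  open Sum (CommutativeRing.+-monoid +-*-commutativeRing) using (sum; sum-cong-≗; sum-init-last)
  open RawMonoid (CommutativeRing.+-rawMonoid +-*-commutativeRing) using () renaming (_×_ to _×ℚ_)

  -- The inequality k! ≥ (k/e)ᵏ

  nat-^ : ∀ m n → nat (m ℕ.^ n) ≡ nat m ^ n
  nat-^ m zero    = refl
  nat-^ m (suc n) = trans (nat-* m (m ℕ.^ n)) (cong (nat m *_) (nat-^ m n))

  ×ℚ≡nat* : ∀ n x → n ×ℚ x ≡ nat n * x
  ×ℚ≡nat* zero    x = sym (*-zeroˡ x)
  ×ℚ≡nat* (suc n) x = begin
    x + n ×ℚ x             ≡⟨ cong₂ _+_ (sym (*-identityˡ x)) (×ℚ≡nat* n x) ⟩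
    1ℚ * x + nat n * x     ≡⟨ *-distribʳ-+ x 1ℚ (nat n) ⟨
    (1ℚ + nat n) * x       ≡⟨ cong (_* x) (nat-suc n) ⟨
    nat (suc n) * x        ∎
    where open ≡-Reasoning

  nP′k≤n^k : ∀ n k → n P′ k ℕ.≤ n ℕ.^ k
  nP′k≤n^k n zero    = ℕ.≤-refl
  nP′k≤n^k n (suc k) = ℕ.*-mono-≤ (ℕ.m∸n≤m n k) (nP′k≤n^k n k)

  nPk≤n^k : ∀ n k → n P k ℕ.≤ n ℕ.^ k
  nPk≤n^k n k with k ℕ.≤ᵇ n
  ... | true  = nP′k≤n^k n k
  ... | false = ℕ.z≤n

  -- `n P k` is at most a product of `k` factors `n`, and the rounding in its division by `k !` only
  -- lowers the left side.
  nCk*k!≤n^k : ∀ {n k} → k ℕ.≤ n → (n C k) ℕ.* k ! ℕ.≤ n ℕ.^ k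
  nCk*k!≤n^k {n} {k} k≤n = ℕ.≤-trans
    (ℕ.≤-reflexive (cong (ℕ._* k !) (nCk≡nPk/k! k≤n)))
    (ℕ.≤-trans (ℕ.m/n*n≤m (n P k) (k !) {{k ℕ.!≢0}}) (nPk≤n^k n k))

  nCk≤n^k/k! : ∀ {n k} → k ℕ.≤ n → nat (n C k) ≤ invFact k * nat n ^ k
  nCk≤n^k/k! {n} {k} k≤n = begin
    nat (n C k)                              ≡⟨ *-identityʳ (nat (n C k)) ⟨
    nat (n C k) * 1ℚ                         ≡⟨ cong (nat (n C k) *_) (1/k*k≡1 (k !) {{k ℕ.!≢0}}) ⟨
    nat (n C k) * (invFact k * nat (k !))
      ≡⟨ solve 3 (λ a b c → a :* (b :* c) := b :* (a :* c)) refl (nat (n C k)) (invFact k) (nat (k !)) ⟩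
    invFact k * (nat (n C k) * nat (k !))    ≡⟨ cong (invFact k *_) (nat-* (n C k) (k !)) ⟨
    invFact k * nat ((n C k) ℕ.* k !)
      ≤⟨ *-monoˡ-≤ {invFact k} (<⇒≤ (invFact-pos k)) (nat-mono-≤ {(n C k) ℕ.* k !} {n ℕ.^ k} (nCk*k!≤n^k k≤n)) ⟩
    invFact k * nat (n ℕ.^ k)                ≡⟨ cong (invFact k *_) (nat-^ n k) ⟩
    invFact k * nat n ^ k                    ∎
    where
    open ≤-Reasoning
    open +-*-Solver

  1^n≡1 : ∀ n → 1ℚ ^ n ≡ 1ℚ
  1^n≡1 zero    = refl
  1^n≡1 (suc n) = trans (*-identityˡ (1ℚ ^ n)) (1^n≡1 n)

  0≤^ : ∀ {x} n → 0ℚ ≤ x → 0ℚ ≤ x ^ n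
  0≤^ n 0≤x = proj₁ (^-mono-≤ n 0≤x ≤-refl)

  -- From C(n,j) ≤ nʲ/j!, where the factor nⁿ⁻ʲ of the term completes the power.
  binomialTerm-≤ : ∀ n (i : Fin (suc n)) → binomialTerm 1ℚ (nat n) n i ≤ invFact (toℕ i) * nat n ^ n
  binomialTerm-≤ n i = begin
    binomialTerm 1ℚ x n i                      ≡⟨ ×ℚ≡nat* (n C j) (1ℚ ^ j * x ^ (n ℕ.∸ j)) ⟩
    nat (n C j) * (1ℚ ^ j * x ^ (n ℕ.∸ j))
      ≡⟨ cong (nat (n C j) *_) (trans (cong (_* x ^ (n ℕ.∸ j)) (1^n≡1 j)) (*-identityˡ _)) ⟩
    nat (n C j) * x ^ (n ℕ.∸ j)
      ≤⟨ *-monoʳ-≤ {x ^ (n ℕ.∸ j)} (0≤^ (n ℕ.∸ j) (0≤nat n)) (nCk≤n^k/k! {n} {j} j≤n) ⟩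
    invFact j * x ^ j * x ^ (n ℕ.∸ j)          ≡⟨ *-assoc (invFact j) (x ^ j) (x ^ (n ℕ.∸ j)) ⟩
    invFact j * (x ^ j * x ^ (n ℕ.∸ j))        ≡⟨ cong (invFact j *_) (^-homo-* x j (n ℕ.∸ j)) ⟨
    invFact j * x ^ (j ℕ.+ (n ℕ.∸ j))          ≡⟨ cong (λ m → invFact j * x ^ m) (ℕ.m+[n∸m]≡n j≤n) ⟩
    invFact j * x ^ n                          ∎
    where
    open ≤-Reasoning
    x = nat n
    j = toℕ i
    j≤n : j ℕ.≤ n
    j≤n = ℕ.s≤s⁻¹ (Fin.toℕ<n i)

  sum-mono-≤ : ∀ {n} {f g : Fin n → ℚ} → (∀ i → f i ≤ g i) → sum f ≤ sum g
  sum-mono-≤ {zero}  f≤g = ≤-refl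
  sum-mono-≤ {suc n} f≤g = +-mono-≤ (f≤g zero) (sum-mono-≤ (f≤g ∘ suc))

  sum-invFact : ∀ n c → sum {n} (λ i → invFact (toℕ i) * c) ≡ expSum n * c
  sum-invFact zero    c = sym (*-zeroˡ c)
  sum-invFact (suc n) c = begin
    sum {suc n} (λ i → invFact (toℕ i) * c)
      ≡⟨ sum-init-last (λ (i : Fin (suc n)) → invFact (toℕ i) * c) ⟩
    sum {n} (λ i → invFact (toℕ (inject₁ i)) * c) + invFact (toℕ (Fin.fromℕ n)) * c
      ≡⟨ cong₂ (λ s j → s + invFact j * c) (sum-cong-≗ {n} (λ i → cong (λ j → invFact j * c) (Fin.toℕ-inject₁ i))) (Fin.toℕ-fromℕ n) ⟩
    sum {n} (λ i → invFact (toℕ i) * c) + invFact n * c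
      ≡⟨ cong (_+ invFact n * c) (sum-invFact n c) ⟩
    expSum n * c + invFact n * c
      ≡⟨ *-distribʳ-+ c (expSum n) (invFact n) ⟨
    expSum (suc n) * c ∎
    where open ≡-Reasoning

  -- The estimate (1+1/n)ⁿ ≤ Σ 1/j! multiplied by nⁿ, a form that covers n = 0 as well. The binomial
  -- expansion is compared with the series term by term.
  [1+n]^n≤e*n^n : ∀ n → nat (suc n) ^ n ≤ expSum (suc n) * nat n ^ n
  [1+n]^n≤e*n^n n = begin
    nat (suc n) ^ n                                     ≡⟨ cong (_^ n) (nat-suc n) ⟩
    (1ℚ + nat n) ^ n                                    ≡⟨ binomial-theorem n 1ℚ (nat n) ⟩
    sum (binomialTerm 1ℚ (nat n) n)                     ≤⟨ sum-mono-≤ (binomialTerm-≤ n) ⟩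
    sum {suc n} (λ i → invFact (toℕ i) * nat n ^ n)     ≡⟨ sum-invFact (suc n) (nat n ^ n) ⟩
    expSum (suc n) * nat n ^ n                          ∎
    where open ≤-Reasoning

  -- The ratio of consecutive terms of nⁿ/n! is (1+1/n)ⁿ.
  n^n≤e^n*n! : ∀ {s} → (∀ m → expSum m ≤ s) → ∀ n → nat n ^ n ≤ s ^ n * nat (n !)
  n^n≤e^n*n! {s} bound zero    = ≤-refl
  n^n≤e^n*n! {s} bound (suc n) = begin
    nat (suc n) * nat (suc n) ^ n
      ≤⟨ *-monoˡ-≤ {nat (suc n)} (0≤nat (suc n)) ([1+n]^n≤e*n^n n) ⟩
    nat (suc n) * (expSum (suc n) * nat n ^ n)
      ≤⟨ *-monoˡ-≤ {nat (suc n)} (0≤nat (suc n)) (*-monoʳ-≤ {nat n ^ n} (0≤^ n (0≤nat n)) (bound (suc n))) ⟩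
    nat (suc n) * (s * nat n ^ n)
      ≤⟨ *-monoˡ-≤ {nat (suc n)} (0≤nat (suc n)) (*-monoˡ-≤ {s} 0≤s (n^n≤e^n*n! bound n)) ⟩
    nat (suc n) * (s * (s ^ n * nat (n !)))
      ≡⟨ solve 4 (λ a b c d → a :* (b :* (c :* d)) := b :* c :* (a :* d)) refl (nat (suc n)) s (s ^ n) (nat (n !)) ⟩
    s * s ^ n * (nat (suc n) * nat (n !))          ≡⟨ cong (s * s ^ n *_) (nat-* (suc n) (n !)) ⟨
    s * s ^ n * nat (suc n !)                      ∎
    where
    open ≤-Reasoning
    open +-*-Solver
    0≤s : 0ℚ ≤ s
    0≤s = bound 0

  -- Membership of `z` in the lower cut supplies a rational `s` above all partial sums with z s < k.
  -- Then (z s)ᵏ ≤ kᵏ ≤ sᵏ k!, where sᵏ cancels, and z ≤ k because s ≥ 1.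
  k÷e-bounds : ∀ k .{{_ : ℕ.NonZero k}} {z} → 0ℚ < z → L (real (k ÷ℝ e)) z → z ^ k ≤ nat (k !) × z ≤ nat k
  k÷e-bounds k {z} 0<z (s , (s′ , s′<s , bound) , zs<k) =
    *-cancelˡ-≤-pos {z ^ k} {nat (k !)} (s ^ k) {{positive (^-pos k 0<s)}} (begin
      s ^ k * z ^ k         ≡⟨ *-comm (s ^ k) (z ^ k) ⟩
      z ^ k * s ^ k         ≡⟨ ^-distrib-* z s k ⟨
      (z * s) ^ k           ≤⟨ proj₂ (^-mono-≤ k (<⇒≤ (*-pos 0<z 0<s)) (<⇒≤ zs<k)) ⟩
      nat k ^ k             ≤⟨ n^n≤e^n*n! (λ m → ≤-trans (bound m) (<⇒≤ s′<s)) k ⟩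
      s ^ k * nat (k !)     ∎) ,
    (begin
      z                     ≡⟨ *-identityʳ z ⟨
      z * 1ℚ                ≤⟨ *-monoˡ-≤ {z} (<⇒≤ 0<z) 1≤s ⟩
      z * s                 ≤⟨ <⇒≤ zs<k ⟩
      nat k                 ∎)
    where
    open ≤-Reasoning
    1≤s : 1ℚ ≤ s
    1≤s = ≤-trans (bound 1) (<⇒≤ s′<s)
    0<s : 0ℚ < s
    0<s = <-≤-trans 0<1 1≤s

  -- Binary logarithms of rationals

  pow2-+ : ∀ a b → pow2 (a ℤ.+ b) ≡ pow2 a * pow2 b
  pow2-+ (+ n) b = go n
    where
    go : ∀ n → pow2 (+ n ℤ.+ b) ≡ pow2 (+ n) * pow2 b
    go zero    = trans (cong pow2 (ℤ.+-identityˡ b)) (sym (*-identityˡ (pow2 b)))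
    go (suc n) = begin
      pow2 (+ suc n ℤ.+ b)                ≡⟨ cong pow2 (ℤ.+-assoc (+ 1) (+ n) b) ⟩
      pow2 (ℤ.suc (+ n ℤ.+ b))            ≡⟨ pow2-suc (+ n ℤ.+ b) ⟩
      2ℚ * pow2 (+ n ℤ.+ b)               ≡⟨ cong (2ℚ *_) (go n) ⟩
      2ℚ * (pow2 (+ n) * pow2 b)          ≡⟨ *-assoc 2ℚ (pow2 (+ n)) (pow2 b) ⟨
      pow2 (+ suc n) * pow2 b             ∎
      where open ≡-Reasoning
  -- A negative exponent is handled by inserting ½ⁿ⁺¹ 2ⁿ⁺¹ = 1 and applying the nonnegative case to
  -- 2ⁿ⁺¹.
  pow2-+ -[1+ n ] b = begin
    pow2 (-[1+ n ] ℤ.+ b)                               ≡⟨ *-identityˡ _ ⟨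
    1ℚ * pow2 (-[1+ n ] ℤ.+ b)                          ≡⟨ cong (_* pow2 (-[1+ n ] ℤ.+ b)) (½ⁿ2ⁿ≡1 (suc n)) ⟨
    ½ ^ suc n * 2ℚ ^ suc n * pow2 (-[1+ n ] ℤ.+ b)
      ≡⟨ *-assoc (½ ^ suc n) (2ℚ ^ suc n) (pow2 (-[1+ n ] ℤ.+ b)) ⟩
    ½ ^ suc n * (2ℚ ^ suc n * pow2 (-[1+ n ] ℤ.+ b))
      ≡⟨ cong (½ ^ suc n *_) (pow2-+ (+ suc n) (-[1+ n ] ℤ.+ b)) ⟨
    ½ ^ suc n * pow2 (+ suc n ℤ.+ (-[1+ n ] ℤ.+ b))     ≡⟨ cong (λ c → ½ ^ suc n * pow2 c) cancel ⟩
    pow2 -[1+ n ] * pow2 b                              ∎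
    where
    open ≡-Reasoning
    cancel : + suc n ℤ.+ (-[1+ n ] ℤ.+ b) ≡ b
    cancel = trans (sym (ℤ.+-assoc (+ suc n) -[1+ n ] b))
      (trans (cong (ℤ._+ b) (ℤ.+-inverseʳ (+ suc n))) (ℤ.+-identityˡ b))

  -- p < lg z and lg z < p, with denominators cleared as in the definition of lg.
  infix 4 _<lg_ _lg<_ _lg≤_

  _<lg_ _lg<_ _lg≤_ : ℚ → ℚ → Set
  p <lg z = pow2 (↥ p) < z ^ ↧ₙ p
  z lg< p = z ^ ↧ₙ p < pow2 (↥ p)
  z lg≤ p = z ^ ↧ₙ p ≤ pow2 (↥ p)

  *-mono-<-≤ : ∀ {a b c d} → 0ℚ < a → 0ℚ < d → a < b → c ≤ d → a * c < b * d
  *-mono-<-≤ {a} {b} {c} {d} 0<a 0<d a<b c≤d =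
    ≤-<-trans (*-monoˡ-≤ {a} {c} {d} (<⇒≤ 0<a) c≤d) (*-monoʳ-< {d} {a} {b} 0<d a<b)

  module _ (p q : ℚ) (z w : ℚ) where
    open ≡-Reasoning

    private
      a = ↥ p
      b = ↧ₙ p
      c = ↥ q
      d = ↧ₙ q

    pow2-cross : pow2 (a ℤ.* + d ℤ.+ c ℤ.* + b) ≡ pow2 a ^ d * pow2 c ^ b
    pow2-cross = trans (pow2-+ (a ℤ.* + d) (c ℤ.* + b)) (cong₂ _*_ (pow2-^ a d) (pow2-^ c b))

    ^-cross : (z * w) ^ (b ℕ.* d) ≡ (z ^ b) ^ d * (w ^ d) ^ b
    ^-cross = begin
      (z * w) ^ (b ℕ.* d)              ≡⟨ ^-distrib-* z w (b ℕ.* d) ⟩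
      z ^ (b ℕ.* d) * w ^ (b ℕ.* d)    ≡⟨ cong (λ n → z ^ (b ℕ.* d) * w ^ n) (ℕ.*-comm b d) ⟩
      z ^ (b ℕ.* d) * w ^ (d ℕ.* b)    ≡⟨ cong₂ _*_ (^-assocʳ z b d) (^-assocʳ w d b) ⟨
      (z ^ b) ^ d * (w ^ d) ^ b        ∎

  -- Each inequality is raised to the denominator of the other and the two are multiplied. Matching
  -- on `record{}` lets `p + q` unfold to the fraction over the common denominator.
  <lg-+ : ∀ {p q z w} → 0ℚ < z → 0ℚ < w → p <lg z → q <lg w → p + q <lg z * w
  <lg-+ {p@record{}} {q@record{}} {z} {w} 0<z 0<w p<z q<w =
    lower-/ (↥ p ℤ.* ↧ q ℤ.+ ↥ q ℤ.* ↧ p) (↧ₙ p ℕ.* ↧ₙ q) (*-pos 0<z 0<w)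
      (subst₂ _<_ (sym (pow2-cross p q z w)) (sym (^-cross p q z w))
        (*-mono-<-≤ (^-pos (↧ₙ q) (pow2-pos (↥ p))) (^-pos (↧ₙ p) (^-pos (↧ₙ q) 0<w))
          (^-mono-< (↧ₙ q) (pow2-pos (↥ p)) p<z)
          (proj₂ (^-mono-≤ (↧ₙ p) (<⇒≤ (pow2-pos (↥ q))) (<⇒≤ q<w)))))

  -- The second comparison is weak so that it can be an equality such as lg 2ˡ = l.
  lg<-+ : ∀ {p q z w} → 0ℚ < z → 0ℚ < w → z lg< p → w lg≤ q → z * w lg< p + q
  lg<-+ {p@record{}} {q@record{}} {z} {w} 0<z 0<w z<p w≤q =
    upper-/ (↥ p ℤ.* ↧ q ℤ.+ ↥ q ℤ.* ↧ p) (↧ₙ p ℕ.* ↧ₙ q) (*-pos 0<z 0<w)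
      (subst₂ _<_ (sym (^-cross p q z w)) (sym (pow2-cross p q z w))
        (*-mono-<-≤ (^-pos (↧ₙ q) (^-pos (↧ₙ p) 0<z)) (^-pos (↧ₙ p) (pow2-pos (↥ q)))
          (^-mono-< (↧ₙ q) (^-pos (↧ₙ p) 0<z) z<p)
          (proj₂ (^-mono-≤ (↧ₙ p) (<⇒≤ (^-pos (↧ₙ q) 0<w)) w≤q))))

  <lg-mono : ∀ p {z w} → 0ℚ < z → z ≤ w → p <lg z → p <lg w
  <lg-mono p 0<z z≤w p<z = <-≤-trans p<z (proj₂ (^-mono-≤ (↧ₙ p) (<⇒≤ 0<z) z≤w))

  <lg-lg<⇒< : ∀ {p q z} → 0ℚ < z → p <lg z → z lg< q → p < q
  <lg-lg<⇒< {p} {q} {z} 0<z p<z z<q with p <? q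
  ... | yes p<q = p<q
  ... | no  p≮q = ⊥-elim (<-asym z<q
    (lower-shift {z} {↥ q} {↥ p} (↧ₙ q) (↧ₙ p) 0<z (drop-*≤* (≮⇒≥ p≮q)) p<z))

  negative⇒<lg1 : ∀ {p} → p < 0ℚ → p <lg 1ℚ
  negative⇒<lg1 {mkℚ (+ n) d c} p<0 = ⊥-elim (<-irrefl refl (<-≤-trans p<0 (nonNegative⁻¹ (mkℚ (+ n) d c))))
  negative⇒<lg1 {p@(mkℚ -[1+ n ] d c)} p<0 = subst (½ ^ suc n <_) (sym (1^n≡1 (suc d)))
    (subst (½ ^ suc n <_) (1^n≡1 (suc n)) (^-mono-< (suc n) 0<½ ½<1))

  positive⇒1lg< : ∀ {p} → 0ℚ < p → 1ℚ lg< p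
  positive⇒1lg< {mkℚ -[1+ n ] d c} 0<p = ⊥-elim (<-asym 0<p (negative⁻¹ (mkℚ -[1+ n ] d c)))
  positive⇒1lg< {mkℚ (+ zero) d c} 0<p = ⊥-elim (<-irrefl refl (<-≤-trans 0<p (nonPositive⁻¹ (mkℚ (+ zero) d c))))
  positive⇒1lg< {p@(mkℚ (+ suc n) d c)} 0<p = subst (_< 2ℚ ^ suc n) (sym (1^n≡1 (suc d)))
    (subst (_< 2ℚ ^ suc n) (1^n≡1 (suc n)) (^-mono-< (suc n) 0<1 1<2))

  -- In fact an equality. For a variable `l` the fraction `nat l` does not reduce to numerator `l`
  -- over 1, so `cross-/` supplies the relation.
  2^l-lg≤l : ∀ l → 2ℚ ^ l lg≤ nat l
  2^l-lg≤l l = ≤-reflexive (sym (trans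
    (cong pow2 (trans (sym (ℤ.*-identityʳ (↥ (nat l)))) (cross-/ (+ l) 1)))
    (pow2-^ (+ l) (↧ₙ (nat l)))))

  p+[q-p]≡q : ∀ p q → p + (q - p) ≡ q
  p+[q-p]≡q p q = solve 2 (λ p q → p :+ (q :- p) := q) refl p q
    where open +-*-Solver

  -- Passage to real cuts

  -- The n summands may come with different rationals below y; the largest serves for all of them.
  L-·-lg : ∀ n (y : ℝ⁺) {r} → L (n · lg y) r → ∃[ z ] 0ℚ < z × L (real y) z × r <lg z ^ n
  L-·-lg zero    y r<0 = let (z , 0<z , z∈) = ℝ⁺.L-pos y in z , 0<z , z∈ , negative⇒<lg1 r<0
  L-·-lg (suc n) y {r} (p , (z₁ , 0<z₁ , z₁∈ , p<z₁) , rest) with L-·-lg n y rest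
  ... | z₂ , 0<z₂ , z₂∈ , q<z₂ with ≤-total z₁ z₂
  ...   | inj₁ z₁≤z₂ = z₂ , 0<z₂ , z₂∈ , subst (_<lg z₂ * z₂ ^ n) (p+[q-p]≡q p r)
            (<lg-+ {p} {r - p} 0<z₂ (^-pos n 0<z₂) (<lg-mono p 0<z₁ z₁≤z₂ p<z₁) q<z₂)
  ...   | inj₂ z₂≤z₁ = z₁ , 0<z₁ , z₁∈ , subst (_<lg z₁ * z₁ ^ n) (p+[q-p]≡q p r)
            (<lg-+ {p} {r - p} 0<z₁ (^-pos n 0<z₁) p<z₁
              (<lg-mono (r - p) (^-pos n 0<z₂) (proj₂ (^-mono-≤ n (<⇒≤ 0<z₂) z₂≤z₁)) q<z₂))

  -- The witnesses `w` of all summands are at least the same `x`, so powers of `x` itself accumulate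
  -- along the recursion.
  U-·-lg : ∀ n (y : ℝ⁺) {x u} → 0ℚ < x → (∀ {w} → U (real y) w → x ≤ w) → U (n · lg y) u → x ^ n lg< u
  U-·-lg zero    y {x} {u} 0<x x≤y 0<u = positive⇒1lg< {u} 0<u
  U-·-lg (suc n) y {x} {u} 0<x x≤y (p , (w , w∈ , w<p) , rest) = subst (x * x ^ n lg<_) (p+[q-p]≡q p u)
    (lg<-+ {p} {u - p} {x} {x ^ n} 0<x (^-pos n 0<x)
      (≤-<-trans (proj₂ (^-mono-≤ (↧ₙ p) (<⇒≤ 0<x) (x≤y w∈))) w<p)
      (<⇒≤ (U-·-lg n y {x} {u - p} 0<x x≤y rest)))

  -- An element q of the lower cut yields r below n lg y with r - q above N lg y′. For some z below
  -- y, r < lg zⁿ ≤ lg (xᴺ t) < (r - q) + c, hence q < c.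
  ·-lg-difference-< : ∀ n y N y′ {x t c} → 0ℚ < x → 0ℚ < t → (∀ {w} → U (real y′) w → x ≤ w) → t lg≤ c →
                      (∀ {z} → 0ℚ < z → L (real y) z → z ^ n ≤ x ^ N * t) →
                      ∀ q → L (n · lg y -ℝ N · lg y′) q → q < c
  ·-lg-difference-< n y N y′ {x} {t} {c} 0<x 0<t x≤y′ t≤c zⁿ≤ q (r , r∈ , u∈) with L-·-lg n y r∈
  ... | z , 0<z , z∈ , r<zⁿ = subst₂ _<_
    (solve 2 (λ q r → q :- r :+ r := q) refl q r)
    (solve 3 (λ q r c → q :- r :+ (:- (q :- r) :+ c) := c) refl q r c)
    (+-monoʳ-< (q - r) (<lg-lg<⇒< {r} { - (q - r) + c} {x ^ N * t} (*-pos (^-pos N 0<x) 0<t)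
      (<lg-mono r (^-pos n 0<z) (zⁿ≤ 0<z z∈) r<zⁿ)
      (lg<-+ { - (q - r)} {c} {x ^ N} {t} (^-pos N 0<x) 0<t (U-·-lg N y′ {x} { - (q - r)} 0<x x≤y′ u∈) t≤c)))
    where open +-*-Solver

  -- Each full group of `k` factors is charged `f` and each of the `d` remaining ones `x`; these
  -- become k! and k.
  power-bound : ∀ {x f z} d m k → 0ℚ < z → z ≤ x → z ^ k ≤ f → 0ℚ ≤ f → z ^ (d ℕ.+ m ℕ.* k) ≤ x ^ d * f ^ m
  power-bound {x} {f} {z} d m k 0<z z≤x zᵏ≤f 0≤f = begin
    z ^ (d ℕ.+ m ℕ.* k)                  ≡⟨ ^-homo-* z d (m ℕ.* k) ⟩
    z ^ d * z ^ (m ℕ.* k)                ≡⟨ cong (λ j → z ^ d * z ^ j) (ℕ.*-comm m k) ⟩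
    z ^ d * z ^ (k ℕ.* m)                ≡⟨ cong (z ^ d *_) (^-assocʳ z k m) ⟨
    z ^ d * (z ^ k) ^ m
      ≤⟨ *-monoˡ-≤ {z ^ d} (<⇒≤ (^-pos d 0<z)) (proj₂ (^-mono-≤ m (<⇒≤ (^-pos k 0<z)) zᵏ≤f)) ⟩
    z ^ d * f ^ m                        ≤⟨ *-monoʳ-≤ {f ^ m} (0≤^ m 0≤f) (proj₂ (^-mono-≤ d (<⇒≤ 0<z) z≤x)) ⟩
    x ^ d * f ^ m                        ∎
    where open ≤-Reasoning

  nat-^*^ : ∀ a b c d → nat (a ℕ.^ b ℕ.* c ℕ.^ d) ≡ nat a ^ b * nat c ^ d
  nat-^*^ a b c d = trans (nat-* (a ℕ.^ b) (c ℕ.^ d)) (cong₂ _*_ (nat-^ a b) (nat-^ c d))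

  -- The hypothesis is the claim exponentiated, with (k/e)ⁿ replaced by its upper bound kᵈ (k!)ᵐ for
  -- n = d + m k.
  lg-bound : ∀ k .{{k≢0 : ℕ.NonZero k}} d m N l → k ℕ.^ d ℕ.* (k !) ℕ.^ m ℕ.≤ k ℕ.^ N ℕ.* 2 ℕ.^ l →
             (d ℕ.+ m ℕ.* k) · lg (k ÷ℝ e) -ℝ N · lg (fromℕ⁺ k) ≤ℝ fromℕ l
  lg-bound k {{k≢0}} d m N l h = ·-lg-difference-< (d ℕ.+ m ℕ.* k) (_÷ℝ_ k {{k≢0}} e) N (fromℕ⁺ k {{k≢0}})
    {nat k} {2ℚ ^ l} {nat l} (nat-pos k) (^-pos l 0<2) <⇒≤ (2^l-lg≤l l) λ {z} 0<z z∈ → ≤-trans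
      (power-bound {nat k} {nat (k !)} {z} d m k 0<z
        (proj₂ (k÷e-bounds k 0<z z∈)) (proj₁ (k÷e-bounds k 0<z z∈)) (0≤nat (k !)))
      (subst₂ _≤_ (nat-^*^ k d (k !) m) (nat-^*^ k N 2 l)
        (nat-mono-≤ {k ℕ.^ d ℕ.* (k !) ℕ.^ m} {k ℕ.^ N ℕ.* 2 ℕ.^ l} h))

-- Constants and the final bound

open import Defs using (_≤ℝ_; _-ℝ_; _·_; _÷ℝ_; e; lg; fromℕ; fromℕ⁺; DecisionEncoding)
open import Data.Integer.Base using (+_)
open import Data.List.Base using (length)
open import Data.Nat.Base using (ℕ; NonZero; _*_; _^_; _≤_; _<_)
open import Data.Product.Base using (∃-syntax; _×_)
open import Data.Rational.Base using (_/_)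

open Counting using (long-code)
open Logarithms using (lg-bound)
open import Data.Nat.Base using (suc; _+_; _∸_; _!; z<s; >-nonZero)
import Data.Nat.DivMod as ℕ
open import Data.Nat.DivMod using (m≡m%n+[m/n]*n; m%n<n; m/n*n≤m)
open import Data.Nat.Properties
open import Data.Product.Base using (_,_)
open import Data.Vec.Base using (Vec; replicate)
open import Relation.Binary.PropositionalEquality
open import Relation.Nullary using (yes; no)

-- Strictness makes room for the exponent `suc (k * k + k)`: gadget, incomplete permutation, and one
-- factor `k` for the spare bit.
k*k+k<k^4 : ∀ {k} → 2 ≤ k → k * k + k < k ^ 4
k*k+k<k^4 {k} 2≤k = begin-strict
  k * k + k                ≡⟨ +-comm (k * k) k ⟩
  k + k * k                <⟨ +-monoˡ-< (k * k) (begin-strict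
    k                        ≡⟨ *-identityˡ k ⟨
    1 * k                    <⟨ *-monoˡ-< k 2≤k ⟩
    k * k                    ∎) ⟩
  k * k + k * k            ≡⟨ cong (λ j → k * k + j) (+-identityʳ (k * k)) ⟨
  2 * (k * k)              ≤⟨ *-monoˡ-≤ (k * k) (≤-trans 2≤k (m≤m*n k k)) ⟩
  (k * k) * (k * k)        ≡⟨ *-assoc k k (k * k) ⟩
  k * (k * (k * k))        ≡⟨ cong (λ j → k * (k * (k * j))) (*-identityʳ k) ⟨
  k ^ 4                    ∎
  where
  open ≤-Reasoning
  instance _ = >-nonZero (<⇒≤ 2≤k)

-- The spare factor 2 in 2ˡ⁺¹ is at most k and joins the powers of k.
code-bound : ∀ {k d m l} → 2 ≤ k → d ≤ k * k + k → (k !) ^ m < 2 ^ suc l →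
             k ^ d * (k !) ^ m ≤ k ^ (1 * k ^ 4) * 2 ^ l
code-bound {k} {d} {m} {l} 2≤k d≤ h = begin
  k ^ d * (k !) ^ m                    ≤⟨ *-mono-≤ (^-monoʳ-≤ k d≤) (<⇒≤ h) ⟩
  k ^ (k * k + k) * (2 * 2 ^ l)        ≤⟨ *-monoʳ-≤ (k ^ (k * k + k)) (*-monoˡ-≤ (2 ^ l) 2≤k) ⟩
  k ^ (k * k + k) * (k * 2 ^ l)        ≡⟨ *-assoc (k ^ (k * k + k)) k (2 ^ l) ⟨
  k ^ (k * k + k) * k * 2 ^ l          ≡⟨ cong (_* 2 ^ l) (*-comm (k ^ (k * k + k)) k) ⟩
  k ^ suc (k * k + k) * 2 ^ l          ≤⟨ *-monoˡ-≤ (2 ^ l) (^-monoʳ-≤ k (k*k+k<k^4 2≤k)) ⟩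
  k ^ (k ^ 4) * 2 ^ l                  ≡⟨ cong (λ N → k ^ N * 2 ^ l) (*-identityˡ (k ^ 4)) ⟨
  k ^ (1 * k ^ 4) * 2 ^ l              ∎
  where
  open ≤-Reasoning
  instance _ = >-nonZero (<⇒≤ 2≤k)

lg-bound-from-code : ∀ k .{{k≢0 : NonZero k}} → 2 ≤ k → ∀ {n} d m l → d + m * k ≡ n → d ≤ k * k + k →
                     (k !) ^ m < 2 ^ suc l → n · lg (k ÷ℝ e) -ℝ (1 * k ^ 4) · lg (fromℕ⁺ k) ≤ℝ fromℕ l
lg-bound-from-code k {{k≢0}} 2≤k d m l refl d≤ h =
  lg-bound k {{k≢0}} d m (1 * k ^ 4) l (code-bound {k} {d} {m} {l} 2≤k d≤ h)

theorem4 : ∃[ C ] 0 < C ×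
    (∀ (k : ℕ) .{{_ : NonZero k}} → 2 ≤ k →
    ∀ (n : ℕ) (D : DecisionEncoding (+ 1 / k) n) →
    ∃[ A ] n · lg (k ÷ℝ e) -ℝ (C * k ^ 4) · lg (fromℕ⁺ k)
    ≤ℝ fromℕ (length (DecisionEncoding.encode D A)))
-- C = 1 suffices, since k² + k + 1 ≤ k⁴ for k ≥ 2.
theorem4 = 1 , ≤-refl , bound
  where
  bound : ∀ k .{{_ : NonZero k}} → 2 ≤ k → ∀ n (D : DecisionEncoding (+ 1 / k) n) →
          ∃[ A ] n · lg (k ÷ℝ e) -ℝ (1 * k ^ 4) · lg (fromℕ⁺ k) ≤ℝ fromℕ (length (DecisionEncoding.encode D A))
  bound k {{k≢0}} 2≤k n D with k * k ≤? n
  -- The gadget does not fit. With m = 0 all n < k² positions are left over, and 1 < 2ˡ⁺¹ holds for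
  -- any array.
  ... | no kk≰n = A , lg-bound-from-code k {{k≢0}} 2≤k n 0 (length (DecisionEncoding.encode D A)) (+-identityʳ n)
      (≤-trans (<⇒≤ (≰⇒> kk≰n)) (m≤m+n (k * k) k))
      (^-monoʳ-< 2 ≤-refl {0} {suc (length (DecisionEncoding.encode D A))} z<s)
    where
    A : Vec ℕ n
    A = replicate n 0
  ... | yes kk≤n =
    let (A , k!ᵐ<) = long-code k m D fits
    -- The left-over positions are those of the gadget and the `r` entries past the last full
    -- permutation.
    in A , lg-bound-from-code k {{k≢0}} 2≤k (k * k + r) m (length (DecisionEncoding.encode D A))
             (trans (+-assoc (k * k) r (m * k))
               (trans (cong (λ j → k * k + j) (sym (m≡m%n+[m/n]*n (n ∸ k * k) k))) (m+[n∸m]≡n kk≤n)))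
             (+-monoʳ-≤ (k * k) (<⇒≤ (m%n<n (n ∸ k * k) k)))
             k!ᵐ<
    where
    m = (n ∸ k * k) ℕ./ k
    r = (n ∸ k * k) ℕ.% k
    fits : k * k + m * k ≤ n
    fits = ≤-trans (+-monoʳ-≤ (k * k) (m/n*n≤m (n ∸ k * k) k)) (≤-reflexive (m+[n∸m]≡n kk≤n))
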